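{- Let $n$ be a non-negative integer, and let $I^{[n]}\subset\Lambda/\mathcal{I}_n$ be the ideal generated by the elements $$\beta_k^{[n]}:=e_k+\sum_{j\geq k}(-1)^{j+1}\binom{j}{k}e_j\in\Lambda/\mathcal{I}_n,\qquad k\geq 0.$$ Suppose $f\in\Lambda$ satisfies $\overline{f}\in I^{[n]}$, where $\overline{f}$ is the reduction of $f$ modulo $\mathcal{I}_n$. Then the congruence $$f\left(\frac{p}{1},\frac{p}{2},\ldots,\frac{p}{p-1}\right)\equiv 0\mod p^n$$ holds for all sufficiently large primes $p$.
   Context: $\Lambda=\Lambda_{\mathbb{Q}}$ is the ring of symmetric functions over $\mathbb{Q}$: formal power series of bounded degree in countably many variables with rational coefficients, invariant under all permutations of the variables. $e_k$ is the $k$-th elementary symmetric function ($e_0=1$); $\Lambda$ is the free commutative $\mathbb{Q}$-algebra on $e_1,e_2,\ldots$. A symmetric function is evaluated at a finite list of rationals by setting the remaining variables to $0$. The grading by $H$-degree on $\Lambda$ is the multiplicative grading in which $e_k$ (for $k\geq 1$) is homogeneous of $H$-degree $k+1$ (constants have $H$-degree $0$). For $f=\sum_m f_m$ with $f_m$ homogeneous of $H$-degree $m$, put $v(f):=\inf\{m: f_m\neq 0\}\in\mathbb{Z}_{\geq 0}\cup\{\infty\}$, and define the ideal $\mathcal{I}_n:=\{f\in\Lambda: v(f)\geq n\}$. The sum defining $\beta_k^{[n]}$ is finite since $e_j\in\mathcal{I}_n$ for all sufficiently large $j$. For $f\in\Lambda$ and all sufficiently large primes $p$ the value $f(p/1,\ldots,p/(p-1))$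 lies in the localization $\mathbb{Z}_{(p)}$, and congruences modulo $p^n$ are understood in $\mathbb{Z}_{(p)}$. -}

module Defs where

open import Algebra.Bundles using (CommutativeMonoid; CommutativeRing; Semiring)
open import Data.Bool.Base using (Bool; true; false; _∧_; if_then_else_)
open import Data.Bool.ListAction using (and)
open import Data.Bool.Properties using (∧-assoc; ∧-comm)
open import Data.Fin.Base using (Fin; toℕ)
open import Data.Fin.Properties using (toℕ≤pred[n])
open import Data.Integer.Base as ℤ using (ℤ; +_; -1ℤ)
open import Data.List.Base using (List; []; _∷_; _∷ʳ_; map; upTo)
open import Data.List.Relation.Binary.Permutation.Propositional
  using (_↭_; refl; prep; swap; trans)
open import Data.Nat.Base as ℕ using (ℕ; zero; suc; _≤_; _<_; _≤ᵇ_; _≡ᵇ_; _∸_)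
open import Data.Nat.Combinatorics using (_C_)
open import Data.Nat.Divisibility using (_∣_)
open import Data.Nat.ListAction using (sum)
open import Data.Nat.ListAction.Properties using (sum-↭)
import Data.Nat.Properties as ℕ
open import Data.Product.Base using (Σ-syntax; _×_; _,_)
open import Data.Rational.Base as ℚ using (ℚ; 0ℚ; 1ℚ; _/_; ↧ₙ_)
import Data.Rational.Properties as ℚ
open import Data.Sum.Base using (_⊎_; inj₁; inj₂)
open import Data.Vec.Functional using (Vector)
open import Function.Base using (_∘_)
open import Level using (0ℓ)
open import Relation.Binary.PropositionalEquality
  using (_≡_; refl; sym; cong; cong₂; subst; module ≡-Reasoning)
  renaming (trans to ≡-trans)
open import Relation.Nullary using (¬_; yes; no; contradiction)

private
  ℚ-semiring : Semiring 0ℓ 0ℓ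
  ℚ-semiring = CommutativeRing.semiring ℚ.+-*-commutativeRing

open import Algebra.Properties.Semiring.Sum ℚ-semiring
  using (sum-cong-≗; sum-replicate-zero; ∑-comm; sum-syntax; sum⁺-syntax)
open import Algebra.Properties.Semiring.Exp ℚ-semiring using () renaming (_^_ to _^ℚ_)

-- A monomial x₀^α₀ ⋯ xᵣ^αᵣ in the variables x₀, x₁, … is given by its list of
-- exponents α, in which trailing zeros are immaterial.
Series : Set
Series = List ℕ → ℚ

section : Series → ℕ → Series
section f i α = f (i ∷ α)

-- The Cauchy product: the sum of f β * g γ over all β + γ = α.
_⊛_ : Series → Series → Series
(f ⊛ g) []      = f [] ℚ.* g []
(f ⊛ g) (a ∷ α) = ∑[ i ≤ a ] (section f (toℕ i) ⊛ section g (a ∸ toℕ i)) α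

record Λ : Set where
  field
    coeff     : Series
    -- coeff depends only on the monomial, not on the list representing it
    padding   : ∀ α → coeff (α ∷ʳ 0) ≡ coeff α
    symmetric : ∀ {α β} → α ↭ β → coeff α ≡ coeff β
    bound     : ℕ
    bounded   : ∀ α → bound < sum α → coeff α ≡ 0ℚ

open Λ public

infix 4 _≈_
_≈_ : Λ → Λ → Set
f ≈ g = ∀ α → coeff f α ≡ coeff g α

infixl 6 _+_ _-_
infixl 7 _*_ _•_

0Λ : Λ
0Λ = record
  { coeff     = λ _ → 0ℚ
  ; padding   = λ _ → refl
  ; symmetric = λ _ → refl
  ; bound     = 0
  ; bounded   = λ _ _ → refl
  }

_+_ : Λ → Λ → Λ
f + g = record
  { coeff     = λ α → coeff f α ℚ.+ coeff g α
  ; padding   = λ α → cong₂ ℚ._+_ (padding f α) (padding g α)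
  ; symmetric = λ π → cong₂ ℚ._+_ (symmetric f π) (symmetric g π)
  ; bound     = bound f ℕ.+ bound g
  ; bounded   = λ α lt → ≡-trans
      (cong₂ ℚ._+_
        (bounded f α (ℕ.≤-<-trans (ℕ.m≤m+n (bound f) (bound g)) lt))
        (bounded g α (ℕ.≤-<-trans (ℕ.m≤n+m (bound g) (bound f)) lt)))
      (ℚ.+-identityˡ 0ℚ)
  }

_•_ : ℚ → Λ → Λ
q • f = record
  { coeff     = λ α → q ℚ.* coeff f α
  ; padding   = λ α → cong (q ℚ.*_) (padding f α)
  ; symmetric = λ π → cong (q ℚ.*_) (symmetric f π)
  ; bound     = bound f
  ; bounded   = λ α lt → ≡-trans (cong (q ℚ.*_) (bounded f α lt)) (ℚ.*-zeroʳ q)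
  }

_-_ : Λ → Λ → Λ
f - g = f + (ℚ.- 1ℚ) • g

⊛-cong : ∀ {f f′ g g′} → (∀ α → f α ≡ f′ α) → (∀ α → g α ≡ g′ α) →
         ∀ α → (f ⊛ g) α ≡ (f′ ⊛ g′) α
⊛-cong p q []      = cong₂ ℚ._*_ (p []) (q [])
⊛-cong p q (a ∷ α) = sum-cong-≗ {suc a} λ i →
  ⊛-cong (λ β → p (toℕ i ∷ β)) (λ γ → q (a ∸ toℕ i ∷ γ)) α

⊛-padding : ∀ {f g} → (∀ α → f (α ∷ʳ 0) ≡ f α) → (∀ α → g (α ∷ʳ 0) ≡ g α) →
            ∀ α → (f ⊛ g) (α ∷ʳ 0) ≡ (f ⊛ g) α
⊛-padding p q []      =
  ≡-trans (ℚ.+-identityʳ _) (cong₂ ℚ._*_ (p []) (q []))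
⊛-padding p q (a ∷ α) = sum-cong-≗ {suc a} λ i →
  ⊛-padding (λ β → p (toℕ i ∷ β)) (λ γ → q (a ∸ toℕ i ∷ γ)) α

⊛-symmetric : ∀ {f g} → (∀ {α β} → α ↭ β → f α ≡ f β) →
              (∀ {α β} → α ↭ β → g α ≡ g β) →
              ∀ {α β} → α ↭ β → (f ⊛ g) α ≡ (f ⊛ g) β
⊛-symmetric p q refl = refl
⊛-symmetric p q (prep a π) = sum-cong-≗ {suc a} λ i →
  ⊛-symmetric (λ ρ → p (prep (toℕ i) ρ)) (λ ρ → q (prep (a ∸ toℕ i) ρ)) π
⊛-symmetric {f} {g} p q (swap {xs = α} {ys = β} a b π) = begin
  ∑[ i ≤ a ] ∑[ j ≤ b ] term i j
    ≡⟨ ∑-comm {suc a} {suc b} term ⟩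
  ∑[ j ≤ b ] ∑[ i ≤ a ] term i j
    ≡⟨ sum-cong-≗ {suc b} (λ j → sum-cong-≗ {suc a} (λ i → ≡-trans
         (⊛-symmetric
           (λ ρ → p (prep (toℕ i) (prep (toℕ j) ρ)))
           (λ ρ → q (prep (a ∸ toℕ i) (prep (b ∸ toℕ j) ρ))) π)
         (⊛-cong
           (λ γ → p (swap (toℕ i) (toℕ j) refl))
           (λ γ → q (swap (a ∸ toℕ i) (b ∸ toℕ j) refl)) β))) ⟩
  ∑[ j ≤ b ] ∑[ i ≤ a ] (section (section f (toℕ j)) (toℕ i) ⊛
                         section (section g (b ∸ toℕ j)) (a ∸ toℕ i)) β ∎
  where
  open ≡-Reasoning
  term : Fin (suc a) → Fin (suc b) → ℚ
  term i j = (section (section f (toℕ i)) (toℕ j) ⊛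
              section (section g (a ∸ toℕ i)) (b ∸ toℕ j)) α
⊛-symmetric p q (trans π ρ) = ≡-trans (⊛-symmetric p q π) (⊛-symmetric p q ρ)

private
  <+-split : ∀ {m n i j} → m ℕ.+ n < i ℕ.+ j → m < i ⊎ n < j
  <+-split {m} {n} {i} {j} lt with m ℕ.<? i | n ℕ.<? j
  ... | yes m<i | _       = inj₁ m<i
  ... | no _    | yes n<j = inj₂ n<j
  ... | no m≮i  | no n≮j  = contradiction lt
        (ℕ.≤⇒≯ (ℕ.+-mono-≤ (ℕ.≮⇒≥ m≮i) (ℕ.≮⇒≥ n≮j)))

  regroup : ∀ {a} i j s {k} → k ≤ a →
            i ℕ.+ j ℕ.+ (a ℕ.+ s) ≡ (i ℕ.+ k) ℕ.+ (j ℕ.+ (a ∸ k)) ℕ.+ s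
  regroup {a} i j s {k} k≤a = begin
    i ℕ.+ j ℕ.+ (a ℕ.+ s)
      ≡⟨ sym (ℕ.+-assoc (i ℕ.+ j) a s) ⟩
    i ℕ.+ j ℕ.+ a ℕ.+ s
      ≡⟨ cong (λ t → i ℕ.+ j ℕ.+ t ℕ.+ s) (sym (ℕ.m+[n∸m]≡n k≤a)) ⟩
    i ℕ.+ j ℕ.+ (k ℕ.+ (a ∸ k)) ℕ.+ s
      ≡⟨ cong (ℕ._+ s) (ℕ.+-assoc i j _) ⟩
    i ℕ.+ (j ℕ.+ (k ℕ.+ (a ∸ k))) ℕ.+ s
      ≡⟨ cong (λ t → i ℕ.+ t ℕ.+ s) (sym (ℕ.+-assoc j k _)) ⟩
    i ℕ.+ (j ℕ.+ k ℕ.+ (a ∸ k)) ℕ.+ s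
      ≡⟨ cong (λ t → i ℕ.+ (t ℕ.+ (a ∸ k)) ℕ.+ s) (ℕ.+-comm j k) ⟩
    i ℕ.+ (k ℕ.+ j ℕ.+ (a ∸ k)) ℕ.+ s
      ≡⟨ cong (λ t → i ℕ.+ t ℕ.+ s) (ℕ.+-assoc k j _) ⟩
    i ℕ.+ (k ℕ.+ (j ℕ.+ (a ∸ k))) ℕ.+ s
      ≡⟨ cong (ℕ._+ s) (sym (ℕ.+-assoc i k _)) ⟩
    (i ℕ.+ k) ℕ.+ (j ℕ.+ (a ∸ k)) ℕ.+ s ∎
    where open ≡-Reasoning

-- f and g play the role of iterated sections, of total degrees i and j, of series
-- vanishing in degrees above m and n.
⊛-bounded : ∀ {f g m n} i j →
            (∀ α → m < i ℕ.+ sum α → f α ≡ 0ℚ) →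
            (∀ α → n < j ℕ.+ sum α → g α ≡ 0ℚ) →
            ∀ α → m ℕ.+ n < i ℕ.+ j ℕ.+ sum α → (f ⊛ g) α ≡ 0ℚ
⊛-bounded {f} {g} {m} {n} i j p q [] lt
  with <+-split {m} {n} {i} {j} (subst (m ℕ.+ n <_) (ℕ.+-identityʳ (i ℕ.+ j)) lt)
... | inj₁ m<i = ≡-trans
  (cong (ℚ._* g []) (p [] (subst (m <_) (sym (ℕ.+-identityʳ i)) m<i)))
  (ℚ.*-zeroˡ (g []))
... | inj₂ n<j = ≡-trans
  (cong (f [] ℚ.*_) (q [] (subst (n <_) (sym (ℕ.+-identityʳ j)) n<j)))
  (ℚ.*-zeroʳ (f []))
⊛-bounded {f} {g} {m} {n} i j p q (a ∷ α) lt = ≡-trans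
  (sum-cong-≗ {suc a} (λ k → ⊛-bounded (i ℕ.+ toℕ k) (j ℕ.+ (a ∸ toℕ k))
    (λ β → p (toℕ k ∷ β) ∘ subst (m <_) (ℕ.+-assoc i (toℕ k) (sum β)))
    (λ γ → q (a ∸ toℕ k ∷ γ) ∘ subst (n <_) (ℕ.+-assoc j (a ∸ toℕ k) (sum γ)))
    α
    (subst (m ℕ.+ n <_) (regroup i j (sum α) (toℕ≤pred[n] k)) lt)))
  (sum-replicate-zero (suc a))

_*_ : Λ → Λ → Λ
f * g = record
  { coeff     = coeff f ⊛ coeff g
  ; padding   = ⊛-padding (padding f) (padding g)
  ; symmetric = ⊛-symmetric (symmetric f) (symmetric g)
  ; bound     = bound f ℕ.+ bound g
  ; bounded   = ⊛-bounded 0 0 (bounded f) (bounded g)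
  }

+-commutativeMonoid : CommutativeMonoid 0ℓ 0ℓ
+-commutativeMonoid = record
  { Carrier = Λ ; _≈_ = _≈_ ; _∙_ = _+_ ; ε = 0Λ
  ; isCommutativeMonoid = record
    { isMonoid = record
      { isSemigroup = record
        { isMagma = record
          { isEquivalence = record
            { refl  = λ _ → refl
            ; sym   = λ p α → sym (p α)
            ; trans = λ p q α → ≡-trans (p α) (q α)
            }
          ; ∙-cong = λ p q α → cong₂ ℚ._+_ (p α) (q α)
          }
        ; assoc = λ f g h α → ℚ.+-assoc (coeff f α) (coeff g α) (coeff h α)
        }
      ; identity = (λ f α → ℚ.+-identityˡ (coeff f α))
                 , (λ f α → ℚ.+-identityʳ (coeff f α))
      }
    ; comm = λ f g α → ℚ.+-comm (coeff f α) (coeff g α)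
    }
  }

import Algebra.Properties.CommutativeMonoid.Sum +-commutativeMonoid as Λ-Sum

infixl 10 sumΛ-syntax
sumΛ-syntax : ∀ n → Vector Λ n → Λ
sumΛ-syntax _ = Λ-Sum.sum

syntax sumΛ-syntax n (λ i → f) = ∑Λ[ i < n ] f

squarefree : List ℕ → Bool
squarefree α = and (map (_≤ᵇ 1) α)

e-coeff : ℕ → Series
e-coeff k α = if squarefree α ∧ (sum α ≡ᵇ k) then 1ℚ else 0ℚ

private
  squarefree-padding : ∀ α → squarefree (α ∷ʳ 0) ≡ squarefree α
  squarefree-padding []      = refl
  squarefree-padding (a ∷ α) = cong ((a ≤ᵇ 1) ∧_) (squarefree-padding α)

  sum-padding : ∀ α → sum (α ∷ʳ 0) ≡ sum α
  sum-padding []      = refl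
  sum-padding (a ∷ α) = cong (a ℕ.+_) (sum-padding α)

  squarefree-↭ : ∀ {α β} → α ↭ β → squarefree α ≡ squarefree β
  squarefree-↭ refl       = refl
  squarefree-↭ (prep a π) = cong ((a ≤ᵇ 1) ∧_) (squarefree-↭ π)
  squarefree-↭ (swap {xs = α} {ys = β} a b π) = begin
    (a ≤ᵇ 1) ∧ (b ≤ᵇ 1) ∧ squarefree α
      ≡⟨ sym (∧-assoc (a ≤ᵇ 1) (b ≤ᵇ 1) (squarefree α)) ⟩
    ((a ≤ᵇ 1) ∧ (b ≤ᵇ 1)) ∧ squarefree α
      ≡⟨ cong₂ _∧_ (∧-comm (a ≤ᵇ 1) (b ≤ᵇ 1)) (squarefree-↭ π) ⟩
    ((b ≤ᵇ 1) ∧ (a ≤ᵇ 1)) ∧ squarefree β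
      ≡⟨ ∧-assoc (b ≤ᵇ 1) (a ≤ᵇ 1) (squarefree β) ⟩
    (b ≤ᵇ 1) ∧ (a ≤ᵇ 1) ∧ squarefree β ∎
    where open ≡-Reasoning
  squarefree-↭ (trans π ρ) = ≡-trans (squarefree-↭ π) (squarefree-↭ ρ)

  <⇒≢ᵇ : ∀ {k s} → k < s → (s ≡ᵇ k) ≡ false
  <⇒≢ᵇ {zero}  {suc s} _           = refl
  <⇒≢ᵇ {suc k} {suc s} (ℕ.s≤s lt) = <⇒≢ᵇ lt

  e-coeff-bounded : ∀ k α → k < sum α → e-coeff k α ≡ 0ℚ
  e-coeff-bounded k α lt with squarefree α
  ... | true  = cong (if_then 1ℚ else 0ℚ) (<⇒≢ᵇ lt)
  ... | false = refl

e : ℕ → Λ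
e k = record
  { coeff     = e-coeff k
  ; padding   = λ α → cong₂ (λ b s → if b ∧ (s ≡ᵇ k) then 1ℚ else 0ℚ)
                        (squarefree-padding α) (sum-padding α)
  ; symmetric = λ π → cong₂ (λ b s → if b ∧ (s ≡ᵇ k) then 1ℚ else 0ℚ)
                        (squarefree-↭ π) (sum-↭ π)
  ; bound     = k
  ; bounded   = e-coeff-bounded k
  }

1Λ : Λ
1Λ = e 0

-- IsHomogeneous m f: f is homogeneous of H-degree m, i.e. a linear combination of
-- products e_{λ₁} ⋯ e_{λᵣ} with λᵢ ≥ 1 and (λ₁ + 1) + ⋯ + (λᵣ + 1) = m.
data IsHomogeneous : ℕ → Λ → Set where
  constant : ∀ q → IsHomogeneous 0 (q • 1Λ)
  elem     : ∀ k → 1 ≤ k → IsHomogeneous (k ℕ.+ 1) (e k)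
  zero     : ∀ m → IsHomogeneous m 0Λ
  add      : ∀ {m f g} → IsHomogeneous m f → IsHomogeneous m g → IsHomogeneous m (f + g)
  mul      : ∀ {l m f g} → IsHomogeneous l f → IsHomogeneous m g →
             IsHomogeneous (l ℕ.+ m) (f * g)
  resp     : ∀ {m f g} → f ≈ g → IsHomogeneous m f → IsHomogeneous m g

-- f = ∑ₘ fₘ with fₘ homogeneous of H-degree m.  Since Λ is free on e₁, e₂, …,
-- every f has such a decomposition and its components are unique up to ≈.
record HDecomposition (f : Λ) : Set where
  field
    component   : ℕ → Λ
    homogeneous : ∀ m → IsHomogeneous m (component m)
    cutoff      : ℕ
    vanishing   : ∀ m → cutoff ≤ m → component m ≈ 0Λ
    total       : f ≈ ∑Λ[ m < cutoff ] component (toℕ m)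

open HDecomposition public

-- v(f) ≥ n, i.e. n is a lower bound of { m : fₘ ≠ 0 }.
v_≥_ : Λ → ℕ → Set
v f ≥ n = Σ[ D ∈ HDecomposition f ] (∀ m → ¬ (component D m ≈ 0Λ) → n ≤ m)

infix 4 _∈𝓘_
_∈𝓘_ : Λ → ℕ → Set
f ∈𝓘 n = v f ≥ n

-- Equality of the classes of f and g in Λ/𝓘ₙ.
infix 4 _≈_mod𝓘_
_≈_mod𝓘_ : Λ → Λ → ℕ → Set
f ≈ g mod𝓘 n = f - g ∈𝓘 n

-- A representative of βₖ^[n].  The sum may stop at j < n because e_j ∈ 𝓘ₙ for
-- j ≥ n, and it may start at 0 because j C k = 0 for j < k.
β : ℕ → ℕ → Λ
β n k = e k + ∑Λ[ j < n ] (((-1ℤ ℤ.^ suc (toℕ j) ℤ.* + (toℕ j C k)) / 1) • e (toℕ j))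

-- The class of f in Λ/𝓘ₙ lies in the ideal generated by the classes of the
-- βₖ^[n], k ≥ 0: it is a combination of finitely many of them.
infix 4 _∈I[_]
_∈I[_] : Λ → ℕ → Set
f ∈I[ n ] = Σ[ N ∈ ℕ ] Σ[ g ∈ Vector Λ N ] (f ≈ ∑Λ[ k < N ] (g k * β n (toℕ k)) mod𝓘 n)

-- The sum of f α x^α over exponent vectors α with entries at most d.
evalUpTo : ℕ → Series → List ℚ → ℚ
evalUpTo d f []       = f []
evalUpTo d f (x ∷ xs) = ∑[ a ≤ d ] (x ^ℚ toℕ a ℚ.* evalUpTo d (section f (toℕ a)) xs)

-- Monomials in x₁, …, xᵣ of degree at most bound f have all exponents at most
-- bound f, so no term of f is lost.
eval : Λ → List ℚ → ℚ
eval f = evalUpTo (bound f) (coeff f)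

-- p/1, p/2, …, p/(p-1)
fractions : ℕ → List ℚ
fractions p = map (λ i → + p / suc i) (upTo (p ∸ 1))

-- Membership in ℤ₍ₚ₎ ⊂ ℚ for p prime; ↧ₙ is the denominator in lowest terms.
_∈ℤ₍_₎ : ℚ → ℕ → Set
q ∈ℤ₍ p ₎ = ¬ (p ∣ ↧ₙ q)

-- x ≡ y mod pⁿ in ℤ₍ₚ₎
_≡_mod_^_ : ℚ → ℚ → ℕ → ℕ → Set
x ≡ y mod p ^ n = x ∈ℤ₍ p ₎ × y ∈ℤ₍ p ₎ ×
  Σ[ u ∈ ℚ ] (u ∈ℤ₍ p ₎ × x ℚ.- y ≡ (+ (p ℕ.^ n) / 1) ℚ.* u)

{-# OPTIONS --safe #-}

-- Evaluating at p/1, …, p/(p-1) sends e_k to the coefficient E_k of t^k in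
-- P(t) = ∏ (1 + p t / i).  Pairing i with p - i gives P(-1 - t) = P(t) for odd p,
-- so E_k = ∑_j (-1)^j (j C k) E_j.  Hence the value of β_k^[n] is a combination of
-- the E_j with j ≥ n, each divisible by p^j.
--
-- It remains to see that elements of 𝓘_n take values divisible by p^n, which
-- reduces to p^(k+1) ∣ E_k for 1 ≤ k < p - 1.  As E_k = p^k Q_k with
-- ∑ Q_k t^k = Q(t) = ∏ (1 + t / i), this says p ∣ Q_k.  As in Lagrange's proof of
-- Wilson's theorem, (1 + t) Q(1 + t) = (p + t) Q(t) gives
-- ∑_{j ≥ k} (j+1 C k) Q_j = p Q_k, and p ∣ Q_k follows by descending induction on k.

module Submission where

open import Defs using (Λ; _∈I[_]; eval; fractions; _≡_mod_^_)
open import Defs using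
  (_∈ℤ₍_₎; coeff; padding; symmetric; bound; bounded; Series; section; _⊛_; _≈_; _•_;
   0Λ; 1Λ; e; e-coeff; squarefree; β; evalUpTo; sumΛ-syntax; IsHomogeneous; constant;
   elem; add; mul; resp; component; homogeneous; cutoff; total; _∈𝓘_)
import Defs as Sym
open import Algebra.Bundles using (CommutativeRing)
open import Data.Bool.Base using (if_then_else_)
open import Data.Bool.Properties using (∧-zeroʳ)
open import Data.Fin.Base using (Fin; toℕ) renaming (zero to fzero; suc to fsuc)
open import Data.Fin.Properties using (toℕ<n; toℕ≤pred[n])
open import Data.Integer.Base as ℤ using (ℤ; +_)
import Data.Integer.Properties as ℤ
open import Data.List.Base
  using (List; []; _∷_; _++_; _∷ʳ_; map; applyUpTo; length; replicate)
open import Data.List.Properties using (∷ʳ-++; ++-identityʳ)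
open import Data.List.Relation.Binary.Permutation.Propositional
  using (_↭_; ↭-refl; ↭-trans; ↭-sym; prep)
open import Data.List.Relation.Binary.Permutation.Propositional.Properties
  using () renaming (shift to ↭-shift)
open import Data.List.Relation.Unary.All using (All; []; _∷_)
import Data.List.Relation.Unary.All.Properties as All
open import Data.Nat.Base using (ℕ; _≤_)
open import Data.Nat.Base as ℕ using (zero; suc; _<_; _⊔_; z≤n; s≤s)
open import Data.Nat.Combinatorics
  using (_C_; nCk+nC[k+1]≡[n+1]C[k+1]; nC1≡n; nCn≡1; nCk≡nC[n∸k]; k>n⇒nCk≡0)
open import Data.Nat.Coprimality as Coprimality using (coprime-divisor)
open import Data.Nat.Divisibility using (_∣_; divides; ∣-trans; ∣⇒≤)
import Data.Nat.Divisibility as ℕ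
open import Data.Nat.ListAction using (sum)
open import Data.Nat.Primality using (Prime)
open import Data.Nat.Primality
  using (euclidsLemma; prime⇒irreducible; ¬prime[0]; ¬prime[1])
import Data.Nat.Properties as ℕ
import Data.Nat.Solver as ℕ
open import Data.Product.Base using (Σ-syntax)
open import Data.Product.Base using (_,_; proj₁; proj₂)
open import Data.Rational.Base using (0ℚ)
open import Data.Rational.Base
  using (ℚ; 1ℚ; _+_; _*_; -_; _/_; ↥_; ↧_; ↧ₙ_; mkℚ; toℚᵘ)
import Data.Rational.Properties as ℚ
import Data.Rational.Solver as ℚ
open import Data.Rational.Unnormalised.Base as ℚᵘ using (mkℚᵘ; *≡*)
import Data.Rational.Unnormalised.Properties as ℚᵘ
open import Data.Sum.Base using (_⊎_; inj₁; inj₂; [_,_]′)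
open import Data.Vec.Functional using (Vector)
open import Function.Base using (_∘_; _$_; id)
open import Relation.Binary.PropositionalEquality
open import Relation.Nullary using (¬_; contradiction; yes; no)
open import Relation.Nullary.Decidable using (decidable-stable)

-- The number of variables, p - 1, grows with p, so evaluating a fixed f involves ever more of its
-- coefficients. Values are integral for large p only because one bound serves for all denominators
-- at once; symmetry and bounded degree provide it. This covers the multipliers in the ideal, about
-- which nothing else is known. The top coefficient Q_{p-1} = 1/(p-1)! is a unit, so the
-- divisibility by p has to stop at k = p - 2, and each generator e_k has to wait for p > k + 1. In
-- the recurrence, Q_{p-1} is multiplied by (p C k), which supplies the factor p that Q_{p-1} lacks
-- and so lets the descent start. The tail of β reaches the top index as well, but there p^j ∣ E_j
-- is enough. Passing from e_k to 𝓘_n requires evaluation to respect sums and products. `eval` cuts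
-- exponents off at a bound stored with each function, so such identities are compared at a common
-- larger cutoff.

private
  ℚ-semiring = CommutativeRing.semiring ℚ.+-*-commutativeRing

open import Algebra.Properties.Semiring.Sum ℚ-semiring
  using (sum-cong-≗; sum-replicate-zero; ∑-distrib-+; *-distribˡ-sum; sum-syntax; sum⁺-syntax)
open import Algebra.Properties.Semiring.Exp ℚ-semiring
  using () renaming (_^_ to _^ℚ_; ^-homo-* to ^ℚ-+)

-- Divisibility in ℤ₍ₚ₎

ι : ℤ → ℚ
ι z = z / 1

-- `_/_` divides by a gcd and does not compute on open terms. Identities about `ι` are therefore
-- transported to unnormalised fractions, where they become identities of integers.
toℚᵘ-ι : ∀ z → toℚᵘ (ι z) ℚᵘ.≃ mkℚᵘ z 0
toℚᵘ-ι z = ℚ.toℚᵘ-fromℚᵘ (mkℚᵘ z 0)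

ι-+ : ∀ x y → ι (x ℤ.+ y) ≡ ι x + ι y
ι-+ x y = ℚ.toℚᵘ-injective $ begin
  toℚᵘ (ι (x ℤ.+ y))          ≈⟨ toℚᵘ-ι (x ℤ.+ y) ⟩
  mkℚᵘ (x ℤ.+ y) 0            ≈⟨ *≡* (cong (ℤ._* + 1)
    (cong₂ ℤ._+_ (sym (ℤ.*-identityʳ x)) (sym (ℤ.*-identityʳ y)))) ⟩
  mkℚᵘ x 0 ℚᵘ.+ mkℚᵘ y 0      ≈⟨ ℚᵘ.+-cong (toℚᵘ-ι x) (toℚᵘ-ι y) ⟨
  toℚᵘ (ι x) ℚᵘ.+ toℚᵘ (ι y)  ≈⟨ ℚ.toℚᵘ-homo-+ (ι x) (ι y) ⟨
  toℚᵘ (ι x + ι y)            ∎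
  where open ℚᵘ.≃-Reasoning

ι-* : ∀ x y → ι (x ℤ.* y) ≡ ι x * ι y
ι-* x y = ℚ.toℚᵘ-injective $ begin
  toℚᵘ (ι (x ℤ.* y))          ≈⟨ toℚᵘ-ι (x ℤ.* y) ⟩
  mkℚᵘ x 0 ℚᵘ.* mkℚᵘ y 0      ≈⟨ ℚᵘ.*-cong (toℚᵘ-ι x) (toℚᵘ-ι y) ⟨
  toℚᵘ (ι x) ℚᵘ.* toℚᵘ (ι y)  ≈⟨ ℚ.toℚᵘ-homo-* (ι x) (ι y) ⟨
  toℚᵘ (ι x * ι y)            ∎
  where open ℚᵘ.≃-Reasoning

/-*-cancel : ∀ z d .{{_ : ℕ.NonZero d}} → (z / d) * ι (+ d) ≡ ι z
/-*-cancel z d@(suc d-1) = ℚ.toℚᵘ-injective $ begin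
  toℚᵘ (z / d * ι (+ d))          ≈⟨ ℚ.toℚᵘ-homo-* (z / d) (ι (+ d)) ⟩
  toℚᵘ (z / d) ℚᵘ.* toℚᵘ (ι (+ d)) ≈⟨ ℚᵘ.*-cong (ℚ.toℚᵘ-fromℚᵘ (mkℚᵘ z d-1)) (toℚᵘ-ι (+ d)) ⟩
  mkℚᵘ z d-1 ℚᵘ.* mkℚᵘ (+ d) 0    ≈⟨ *≡* (trans (ℤ.*-identityʳ (z ℤ.* + d))
    (cong (λ m → z ℤ.* + suc m) (sym (ℕ.*-identityʳ d-1)))) ⟩
  mkℚᵘ z 0                        ≈⟨ toℚᵘ-ι z ⟨
  toℚᵘ (ι z)                      ∎
  where open ℚᵘ.≃-Reasoning

*-↧ : ∀ q → q * ι (↧ q) ≡ ι (↥ q)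
*-↧ q = trans (cong (_* ι (↧ q)) (sym (ℚ.↥p/↧p≡p q))) (/-*-cancel (↥ q) (↧ₙ q))

-- The numerator n of q satisfies n d = z (↧ q) and is coprime to `↧ q`. Hence any multiplier d that
-- clears the denominator certifies integrality once p does not divide d, and reduced forms of sums
-- and products never have to be computed.
↧∣ : ∀ q d z → q * ι (+ d) ≡ ι z → ↧ₙ q ∣ d
↧∣ q@(mkℚ n d-1 c) d z eq = coprime-divisor
  (Coprimality.sym (Coprimality.recompute c)) (divides ℤ.∣ z ∣ abs-eq)
  where
  cross : toℚᵘ q ℚᵘ.* mkℚᵘ (+ d) 0 ℚᵘ.≃ mkℚᵘ z 0
  cross = begin
    toℚᵘ q ℚᵘ.* mkℚᵘ (+ d) 0     ≈⟨ ℚᵘ.*-congˡ {toℚᵘ q} (toℚᵘ-ι (+ d)) ⟨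
    toℚᵘ q ℚᵘ.* toℚᵘ (ι (+ d))   ≈⟨ ℚ.toℚᵘ-homo-* q (ι (+ d)) ⟨
    toℚᵘ (q * ι (+ d))           ≈⟨ ℚ.toℚᵘ-cong eq ⟩
    toℚᵘ (ι z)                   ≈⟨ toℚᵘ-ι z ⟩
    mkℚᵘ z 0                     ∎
    where open ℚᵘ.≃-Reasoning
  abs-eq : ℤ.∣ n ∣ ℕ.* d ≡ ℤ.∣ z ∣ ℕ.* suc d-1
  abs-eq with *≡* eq′ ← cross = begin
    ℤ.∣ n ∣ ℕ.* d                         ≡⟨ ℤ.abs-* n (+ d) ⟨
    ℤ.∣ n ℤ.* + d ∣                       ≡⟨ cong ℤ.∣_∣ (ℤ.*-identityʳ (n ℤ.* + d)) ⟨
    ℤ.∣ n ℤ.* + d ℤ.* + 1 ∣               ≡⟨ cong ℤ.∣_∣ eq′ ⟩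
    ℤ.∣ z ℤ.* + suc (d-1 ℕ.* 1) ∣           ≡⟨ ℤ.abs-* z (+ suc (d-1 ℕ.* 1)) ⟩
    ℤ.∣ z ∣ ℕ.* suc (d-1 ℕ.* 1)            ≡⟨ cong (λ m → ℤ.∣ z ∣ ℕ.* suc m) (ℕ.*-identityʳ d-1) ⟩
    ℤ.∣ z ∣ ℕ.* suc d-1                    ∎
    where open ≡-Reasoning

module Localization {p : ℕ} (p-prime : Prime p) where

  p∤1 : ¬ p ∣ 1
  p∤1 p∣1 = contradiction (subst Prime (ℕ.∣1⇒≡1 p∣1) p-prime) ¬prime[1]

  p∤* : ∀ {c d} → ¬ p ∣ c → ¬ p ∣ d → ¬ p ∣ c ℕ.* d
  p∤* {c} {d} p∤c p∤d = [ p∤c , p∤d ]′ ∘ euclidsLemma c d p-prime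

  -- A record rather than the bare negation: `x ∈ℤ₍ p ₎` unfolds to a statement about `↧ₙ x`, from
  -- which unification cannot recover x. The same holds for `_∈p^_` below.
  record Integral (x : ℚ) : Set where
    constructor integral
    field ∈ℤ : x ∈ℤ₍ p ₎

  open Integral public

  p∤⇒∈ℤ : ∀ q d z → ¬ p ∣ d → q * ι (+ d) ≡ ι z → Integral q
  p∤⇒∈ℤ q d z p∤d eq = integral λ p∣↧q → p∤d (∣-trans p∣↧q (↧∣ q d z eq))

  ∈ℤ-/ : ∀ z d .{{_ : ℕ.NonZero d}} → ¬ p ∣ d → Integral (z / d)
  ∈ℤ-/ z d p∤d = p∤⇒∈ℤ (z / d) d z p∤d (/-*-cancel z d)

  ∈ℤ-ι : ∀ z → Integral (ι z)
  ∈ℤ-ι z = ∈ℤ-/ z 1 p∤1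

  ∈ℤ-+ : ∀ {x y} → Integral x → Integral y → Integral (x + y)
  ∈ℤ-+ {x} {y} x∈ y∈ = p∤⇒∈ℤ (x + y) (↧ₙ x ℕ.* ↧ₙ y) (↥ x ℤ.* ↧ y ℤ.+ ↥ y ℤ.* ↧ x)
    (p∤* (∈ℤ x∈) (∈ℤ y∈)) $ begin
    (x + y) * ι (+ (↧ₙ x ℕ.* ↧ₙ y))
      ≡⟨ cong (λ d → (x + y) * ι d) (ℤ.pos-* (↧ₙ x) (↧ₙ y)) ⟩
    (x + y) * ι (↧ x ℤ.* ↧ y)
      ≡⟨ cong ((x + y) *_) (ι-* (↧ x) (↧ y)) ⟩
    (x + y) * (ι (↧ x) * ι (↧ y))
      ≡⟨ solve 4 (λ x y a b → (x :+ y) :* (a :* b) := (x :* a) :* b :+ (y :* b) :* a) refl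
           x y (ι (↧ x)) (ι (↧ y)) ⟩
    (x * ι (↧ x)) * ι (↧ y) + (y * ι (↧ y)) * ι (↧ x)
      ≡⟨ cong₂ (λ a b → a * ι (↧ y) + b * ι (↧ x)) (*-↧ x) (*-↧ y) ⟩
    ι (↥ x) * ι (↧ y) + ι (↥ y) * ι (↧ x)
      ≡⟨ cong₂ _+_ (ι-* (↥ x) (↧ y)) (ι-* (↥ y) (↧ x)) ⟨
    ι (↥ x ℤ.* ↧ y) + ι (↥ y ℤ.* ↧ x)
      ≡⟨ ι-+ (↥ x ℤ.* ↧ y) (↥ y ℤ.* ↧ x) ⟨
    ι (↥ x ℤ.* ↧ y ℤ.+ ↥ y ℤ.* ↧ x) ∎
    where
    open ≡-Reasoning
    open ℚ.+-*-Solver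

  ∈ℤ-* : ∀ {x y} → Integral x → Integral y → Integral (x * y)
  ∈ℤ-* {x} {y} x∈ y∈ = p∤⇒∈ℤ (x * y) (↧ₙ x ℕ.* ↧ₙ y) (↥ x ℤ.* ↥ y) (p∤* (∈ℤ x∈) (∈ℤ y∈)) $ begin
    (x * y) * ι (+ (↧ₙ x ℕ.* ↧ₙ y))
      ≡⟨ cong (λ d → (x * y) * ι d) (ℤ.pos-* (↧ₙ x) (↧ₙ y)) ⟩
    (x * y) * ι (↧ x ℤ.* ↧ y)
      ≡⟨ cong ((x * y) *_) (ι-* (↧ x) (↧ y)) ⟩
    (x * y) * (ι (↧ x) * ι (↧ y))
      ≡⟨ solve 4 (λ x y a b → (x :* y) :* (a :* b) := (x :* a) :* (y :* b)) refl
           x y (ι (↧ x)) (ι (↧ y)) ⟩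
    (x * ι (↧ x)) * (y * ι (↧ y))
      ≡⟨ cong₂ _*_ (*-↧ x) (*-↧ y) ⟩
    ι (↥ x) * ι (↥ y)
      ≡⟨ ι-* (↥ x) (↥ y) ⟨
    ι (↥ x ℤ.* ↥ y) ∎
    where
    open ≡-Reasoning
    open ℚ.+-*-Solver

  ∈ℤ-^ : ∀ {x} k → Integral x → Integral (x ^ℚ k)
  ∈ℤ-^ zero    x∈ = ∈ℤ-ι (+ 1)
  ∈ℤ-^ (suc k) x∈ = ∈ℤ-* x∈ (∈ℤ-^ k x∈)

  ∈ℤ-∑ : ∀ n (t : Fin n → ℚ) → (∀ i → Integral (t i)) → Integral (∑[ i < n ] t i)
  ∈ℤ-∑ zero    t t∈ = ∈ℤ-ι (+ 0)
  ∈ℤ-∑ (suc n) t t∈ = ∈ℤ-+ (t∈ fzero) (∈ℤ-∑ n (t ∘ fsuc) (t∈ ∘ fsuc))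

  P^ : ℕ → ℚ
  P^ m = ι (+ (p ℕ.^ m))

  P^-+ : ∀ l m → P^ (l ℕ.+ m) ≡ P^ l * P^ m
  P^-+ l m = trans (cong (λ d → ι (+ d)) (ℕ.^-distribˡ-+-* p l m))
            (trans (cong ι (ℤ.pos-* (p ℕ.^ l) (p ℕ.^ m))) (ι-* (+ (p ℕ.^ l)) (+ (p ℕ.^ m))))

  P^1 : P^ 1 ≡ ι (+ p)
  P^1 = cong (λ d → ι (+ d)) (ℕ.^-identityʳ p)

  infix 4 _∈p^_
  record _∈p^_ (x : ℚ) (m : ℕ) : Set where
    constructor multiple
    field
      quotient : ℚ
      quotient-integral : Integral quotient
      equality : x ≡ P^ m * quotient

  ∈ℤ⇒∈p^0 : ∀ {x} → Integral x → x ∈p^ 0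
  ∈ℤ⇒∈p^0 {x} x∈ = multiple x x∈ (sym (ℚ.*-identityˡ x))

  ∈p^⇒∈ℤ : ∀ {x m} → x ∈p^ m → Integral x
  ∈p^⇒∈ℤ {m = m} (multiple u u∈ refl) = ∈ℤ-* (∈ℤ-ι (+ (p ℕ.^ m))) u∈

  ∈p^⇒≡0 : ∀ {x m} → x ∈p^ m → x ≡ 0ℚ mod p ^ m
  ∈p^⇒≡0 {x} {m} x∈@(multiple u u∈ eq) =
    ∈ℤ (∈p^⇒∈ℤ x∈) , ∈ℤ (∈ℤ-ι (+ 0)) , u , ∈ℤ u∈ , trans (ℚ.+-identityʳ x) eq

  p^∈p^ : ∀ m → P^ m ∈p^ m
  p^∈p^ m = multiple 1ℚ (∈ℤ-ι (+ 1)) (sym (ℚ.*-identityʳ (P^ m)))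

  ∈p^-0 : ∀ m → 0ℚ ∈p^ m
  ∈p^-0 m = multiple 0ℚ (∈ℤ-ι (+ 0)) (sym (ℚ.*-zeroʳ (P^ m)))

  ∈p^-+ : ∀ {x y m} → x ∈p^ m → y ∈p^ m → x + y ∈p^ m
  ∈p^-+ {m = m} (multiple u u∈ refl) (multiple v v∈ refl) =
    multiple (u + v) (∈ℤ-+ u∈ v∈) (sym (ℚ.*-distribˡ-+ (P^ m) u v))

  ∈p^-* : ∀ {x y l m} → x ∈p^ l → y ∈p^ m → x * y ∈p^ (l ℕ.+ m)
  ∈p^-* {l = l} {m} (multiple u u∈ refl) (multiple v v∈ refl) = multiple (u * v) (∈ℤ-* u∈ v∈)
    $ trans (solve 4 (λ a u b v → (a :* u) :* (b :* v) := (a :* b) :* (u :* v)) refl (P^ l) u (P^ m) v)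
          (cong (_* (u * v)) (sym (P^-+ l m)))
    where open ℚ.+-*-Solver

  ∈p^-*ˡ : ∀ {x y m} → Integral x → y ∈p^ m → x * y ∈p^ m
  ∈p^-*ˡ x∈ = ∈p^-* (∈ℤ⇒∈p^0 x∈)

  ∈p^-*ʳ : ∀ {x y m} → x ∈p^ m → Integral y → x * y ∈p^ m
  ∈p^-*ʳ {x} {y} x∈ y∈ = subst (_∈p^ _) (ℚ.*-comm y x) (∈p^-*ˡ y∈ x∈)

  ∈p^-neg : ∀ {x m} → x ∈p^ m → - x ∈p^ m
  ∈p^-neg {x} x∈ = subst (_∈p^ _) (solve 1 (λ x → (:- con 1ℚ) :* x := :- x) refl x) (∈p^-*ˡ (∈ℤ-ι ℤ.-1ℤ) x∈)
    where open ℚ.+-*-Solver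

  ∈p^-≤ : ∀ {x l m} → l ≤ m → x ∈p^ m → x ∈p^ l
  ∈p^-≤ {l = l} {m} l≤m (multiple u u∈ refl) = multiple (P^ (m ℕ.∸ l) * u)
    (∈ℤ-* (∈ℤ-ι (+ (p ℕ.^ (m ℕ.∸ l)))) u∈) $ begin
    P^ m * u                        ≡⟨ cong (λ k → P^ k * u) (ℕ.m+[n∸m]≡n l≤m) ⟨
    P^ (l ℕ.+ (m ℕ.∸ l)) * u        ≡⟨ cong (_* u) (P^-+ l (m ℕ.∸ l)) ⟩
    P^ l * P^ (m ℕ.∸ l) * u         ≡⟨ ℚ.*-assoc (P^ l) (P^ (m ℕ.∸ l)) u ⟩
    P^ l * (P^ (m ℕ.∸ l) * u)       ∎
    where open ≡-Reasoning

  ∈p^-∑ : ∀ n (t : Fin n → ℚ) {m} → (∀ i → t i ∈p^ m) → (∑[ i < n ] t i) ∈p^ m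
  ∈p^-∑ zero    t t∈ = ∈p^-0 _
  ∈p^-∑ (suc n) t t∈ = ∈p^-+ (t∈ fzero) (∈p^-∑ n (t ∘ fsuc) (t∈ ∘ fsuc))

  ∈p^-cancel : ∀ {x m} c → ¬ p ∣ c → ι (+ c) * x ∈p^ m → x ∈p^ m
  ∈p^-cancel zero p∤c _ = contradiction (p ℕ.∣0) p∤c
  ∈p^-cancel {x} c@(suc _) p∤c cx∈ = subst (_∈p^ _) eq (∈p^-*ˡ (∈ℤ-/ (+ 1) c p∤c) cx∈)
    where
    eq : + 1 / c * (ι (+ c) * x) ≡ x
    eq = trans (sym (ℚ.*-assoc (+ 1 / c) (ι (+ c)) x))
        (trans (cong (_* x) (/-*-cancel (+ 1) c)) (ℚ.*-identityˡ x))

-- Polynomials in a variable t as coefficient sequences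

δ : ℕ → ℚ
δ zero    = 1ℚ
δ (suc _) = 0ℚ

shift : (ℕ → ℚ) → ℕ → ℚ
shift c zero    = 0ℚ
shift c (suc k) = c k

-- (u + v t) · c
linear : ℚ → ℚ → (ℕ → ℚ) → ℕ → ℚ
linear u v c k = u * c k + v * shift c k

-- (u₀ + v₀ t) ⋯ (uₙ₋₁ + vₙ₋₁ t)
∏ : (u v : ℕ → ℚ) → ℕ → ℕ → ℚ
∏ u v zero    = δ
∏ u v (suc n) = linear (u n) (v n) (∏ u v n)

shift-cong : ∀ {c d} → c ≗ d → shift c ≗ shift d
shift-cong c≗d zero    = refl
shift-cong c≗d (suc k) = c≗d k

shift-linear : ∀ u v c → shift (linear u v c) ≗ linear u v (shift c)
shift-linear u v c zero    = solve 2 (λ u v → con 0ℚ := u :* con 0ℚ :+ v :* con 0ℚ) refl u v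
  where open ℚ.+-*-Solver
shift-linear u v c (suc k) = refl

linear-cong : ∀ u v {c d} → c ≗ d → linear u v c ≗ linear u v d
linear-cong u v c≗d k = cong₂ (λ x y → u * x + v * y) (c≗d k) (shift-cong c≗d k)

linear-comm : ∀ u v u′ v′ c → linear u v (linear u′ v′ c) ≗ linear u′ v′ (linear u v c)
linear-comm u v u′ v′ c k = begin
  u * (u′ * c k + v′ * shift c k) + v * shift (linear u′ v′ c) k
    ≡⟨ cong (λ x → u * (u′ * c k + v′ * shift c k) + v * x) (shift-linear u′ v′ c k) ⟩
  u * (u′ * c k + v′ * shift c k) + v * (u′ * shift c k + v′ * shift (shift c) k)
    ≡⟨ solve 7 (λ u v u′ v′ x y z →
         u :* (u′ :* x :+ v′ :* y) :+ v :* (u′ :* y :+ v′ :* z) :=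
         u′ :* (u :* x :+ v :* y) :+ v′ :* (u :* y :+ v :* z)) refl
         u v u′ v′ (c k) (shift c k) (shift (shift c) k) ⟩
  u′ * (u * c k + v * shift c k) + v′ * (u * shift c k + v * shift (shift c) k)
    ≡⟨ cong (λ x → u′ * (u * c k + v * shift c k) + v′ * x) (shift-linear u v c k) ⟨
  u′ * (u * c k + v * shift c k) + v′ * shift (linear u v c) k ∎
  where
  open ≡-Reasoning
  open ℚ.+-*-Solver

∏-cong : ∀ n {u u′ v v′} → (∀ {i} → i < n → u i ≡ u′ i) → (∀ {i} → i < n → v i ≡ v′ i) →
         ∏ u v n ≗ ∏ u′ v′ n
∏-cong zero    p q = λ _ → refl
∏-cong (suc n) {u} {u′} {v} {v′} p q k = trans
  (linear-cong (u n) (v n) (∏-cong n (p ∘ ℕ.m<n⇒m<1+n) (q ∘ ℕ.m<n⇒m<1+n)) k)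
  (cong₂ (λ x y → linear x y (∏ u′ v′ n) k) (p ℕ.≤-refl) (q ℕ.≤-refl))

-- `∏` exposes its last factor, whereas the reversal of the factors and the comparison with
-- `elementary` need the first. The two ends can be exchanged because linear factors commute.
∏-front : ∀ u v n → ∏ u v (suc n) ≗ linear (u 0) (v 0) (∏ (u ∘ suc) (v ∘ suc) n)
∏-front u v zero    k = refl
∏-front u v (suc n) k = trans
  (linear-cong (u (suc n)) (v (suc n)) (∏-front u v n) k)
  (linear-comm (u (suc n)) (v (suc n)) (u 0) (v 0) (∏ (u ∘ suc) (v ∘ suc) n) k)

∏-reverse : ∀ u v n → ∏ u v n ≗ ∏ (λ i → u (n ℕ.∸ suc i)) (λ i → v (n ℕ.∸ suc i)) n
∏-reverse u v zero    k = refl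
∏-reverse u v (suc n) k = trans
  (linear-cong (u n) (v n) (∏-reverse u v n) k)
  (sym (∏-front (λ i → u (n ℕ.∸ i)) (λ i → v (n ℕ.∸ i)) n k))

product : (ℕ → ℚ) → ℕ → ℚ
product a zero    = 1ℚ
product a (suc n) = a n * product a n

∏-scale : ∀ a u v n k → ∏ (λ i → a i * u i) (λ i → a i * v i) n k ≡ product a n * ∏ u v n k
∏-scale a u v zero    k = sym (ℚ.*-identityˡ (δ k))
∏-scale a u v (suc n) k = begin
  linear (a n * u n) (a n * v n) (∏ (λ i → a i * u i) (λ i → a i * v i) n) k
    ≡⟨ linear-cong (a n * u n) (a n * v n) (∏-scale a u v n) k ⟩
  a n * u n * (b * c k) + a n * v n * shift (λ k → b * c k) k
    ≡⟨ cong (λ x → a n * u n * (b * c k) + a n * v n * x) (shift-* k) ⟩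
  a n * u n * (b * c k) + a n * v n * (b * shift c k)
    ≡⟨ solve 6 (λ a u v b x y →
         a :* u :* (b :* x) :+ a :* v :* (b :* y) := a :* b :* (u :* x :+ v :* y)) refl
         (a n) (u n) (v n) b (c k) (shift c k) ⟩
  a n * b * linear (u n) (v n) c k ∎
  where
  open ≡-Reasoning
  open ℚ.+-*-Solver
  b = product a n
  c = ∏ u v n
  shift-* : ∀ k → shift (λ k → b * c k) k ≡ b * shift c k
  shift-* zero    = sym (ℚ.*-zeroʳ b)
  shift-* (suc k) = refl

∏-dilate : ∀ a u v n k → ∏ u (λ i → a * v i) n k ≡ (a ^ℚ k) * ∏ u v n k
∏-dilate a u v zero    zero    = refl
∏-dilate a u v zero    (suc k) = sym (ℚ.*-zeroʳ (a ^ℚ suc k))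
∏-dilate a u v (suc n) zero    = begin
  u n * ∏ u (λ i → a * v i) n 0 + a * v n * 0ℚ
    ≡⟨ cong (λ x → u n * x + a * v n * 0ℚ) (∏-dilate a u v n 0) ⟩
  u n * (1ℚ * ∏ u v n 0) + a * v n * 0ℚ
    ≡⟨ solve 4 (λ a u v x → u :* (con 1ℚ :* x) :+ a :* v :* con 0ℚ := con 1ℚ :* (u :* x :+ v :* con 0ℚ)) refl
         a (u n) (v n) (∏ u v n 0) ⟩
  1ℚ * (u n * ∏ u v n 0 + v n * 0ℚ) ∎
  where
  open ≡-Reasoning
  open ℚ.+-*-Solver
∏-dilate a u v (suc n) (suc k) = begin
  u n * ∏ u (λ i → a * v i) n (suc k) + a * v n * ∏ u (λ i → a * v i) n k
    ≡⟨ cong₂ (λ x y → u n * x + a * v n * y) (∏-dilate a u v n (suc k)) (∏-dilate a u v n k) ⟩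
  u n * (a * aᵏ * ∏ u v n (suc k)) + a * v n * (aᵏ * ∏ u v n k)
    ≡⟨ solve 6 (λ a u v b x y → u :* (a :* b :* x) :+ a :* v :* (b :* y) := a :* b :* (u :* x :+ v :* y)) refl
         a (u n) (v n) aᵏ (∏ u v n (suc k)) (∏ u v n k) ⟩
  a * aᵏ * (u n * ∏ u v n (suc k) + v n * ∏ u v n k) ∎
  where
  open ≡-Reasoning
  open ℚ.+-*-Solver
  aᵏ = a ^ℚ k

-- Binomial coefficients and the substitution t ↦ s (1 + t)

binom : ℕ → ℕ → ℚ
binom j k = ι (+ (j C k))

binom-suc : ∀ j k → binom (suc j) k ≡ binom j k + shift (binom j) k
binom-suc j zero    = refl
binom-suc j (suc k) = begin
  ι (+ (suc j C suc k))              ≡⟨ cong (ι ∘ +_) (nCk+nC[k+1]≡[n+1]C[k+1] j k) ⟨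
  ι (+ (j C k) ℤ.+ + (j C suc k))    ≡⟨ ι-+ (+ (j C k)) (+ (j C suc k)) ⟩
  binom j k + binom j (suc k)        ≡⟨ ℚ.+-comm (binom j k) (binom j (suc k)) ⟩
  binom j (suc k) + binom j k        ∎
  where open ≡-Reasoning

-- c(s (1 + t)) for c of degree less than m
substitute : ℚ → ℕ → (ℕ → ℚ) → ℕ → ℚ
substitute s m c k = ∑[ j < m ] ((s ^ℚ toℕ j) * (binom (toℕ j) k * c (toℕ j)))

-- The factor u + v t becomes u + v s (1 + t), and multiplication by 1 + t is Pascal's rule for the
-- `binom` in each term. Since `shift c` starts with 0, its m + 1 terms involve only the first m
-- coefficients of c, hence the shorter sums on the right.
substitute-linear : ∀ s m u v c k → substitute s (suc m) (linear u v c) k ≡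
  u * substitute s (suc m) c k + v * s * (substitute s m c k + shift (substitute s m c) k)
substitute-linear s m u v c k = begin
  ∑[ j < suc m ] ((s ^ℚ toℕ j) * (binom (toℕ j) k * linear u v c (toℕ j)))
    ≡⟨ sum-cong-≗ {suc m} (λ j → split-term (s ^ℚ toℕ j) (binom (toℕ j) k) (c (toℕ j)) (shift c (toℕ j))) ⟩
  ∑[ j < suc m ] (u * (term c j) + v * (term (shift c) j))
    ≡⟨ ∑-distrib-+ {suc m} (λ j → u * (term c j)) (λ j → v * (term (shift c) j)) ⟩
  ∑[ j < suc m ] (u * term c j) + ∑[ j < suc m ] (v * term (shift c) j)
    ≡⟨ cong₂ _+_ (*-distribˡ-sum {suc m} u (term c)) (*-distribˡ-sum {suc m} v (term (shift c))) ⟨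
  u * substitute s (suc m) c k + v * substitute s (suc m) (shift c) k
    ≡⟨ cong (λ x → u * substitute s (suc m) c k + v * x) shifted ⟩
  u * substitute s (suc m) c k + v * (s * (substitute s m c k + shift (substitute s m c) k))
    ≡⟨ cong (λ x → u * substitute s (suc m) c k + x) (ℚ.*-assoc v s _) ⟨
  u * substitute s (suc m) c k + v * s * (substitute s m c k + shift (substitute s m c) k) ∎
  where
  open ≡-Reasoning
  open ℚ.+-*-Solver
  term : (ℕ → ℚ) → ∀ {n} → Fin n → ℚ
  term d j = (s ^ℚ toℕ j) * (binom (toℕ j) k * d (toℕ j))

  split-term : ∀ a b x y → a * (b * (u * x + v * y)) ≡ u * (a * (b * x)) + v * (a * (b * y))
  split-term a b x y = solve 6 (λ u v a b x y →
    a :* (b :* (u :* x :+ v :* y)) := u :* (a :* (b :* x)) :+ v :* (a :* (b :* y))) refl u v a b x y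

  sum-shift : ∀ k → ∑[ j < m ] ((s ^ℚ toℕ j) * (shift (binom (toℕ j)) k * c (toℕ j))) ≡ shift (substitute s m c) k
  sum-shift zero    = trans
    (sum-cong-≗ {m} λ j → solve 2 (λ a x → a :* (con 0ℚ :* x) := con 0ℚ) refl (s ^ℚ toℕ j) (c (toℕ j)))
    (sum-replicate-zero m)
  sum-shift (suc k) = refl

  pascal-term : ∀ j → (s ^ℚ suc j) * (binom (suc j) k * c j) ≡
    s * ((s ^ℚ j) * (binom j k * c j) + (s ^ℚ j) * (shift (binom j) k * c j))
  pascal-term j = trans
    (cong (λ b → (s ^ℚ suc j) * (b * c j)) (binom-suc j k))
    (solve 5 (λ s a b b′ x → s :* a :* ((b :+ b′) :* x) := s :* (a :* (b :* x) :+ a :* (b′ :* x))) refl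
       s (s ^ℚ j) (binom j k) (shift (binom j) k) (c j))

  shifted : substitute s (suc m) (shift c) k ≡ s * (substitute s m c k + shift (substitute s m c) k)
  shifted = begin
    1ℚ * (binom 0 k * 0ℚ) + ∑[ j < m ] ((s ^ℚ suc (toℕ j)) * (binom (suc (toℕ j)) k * c (toℕ j)))
      ≡⟨ cong₂ _+_ (solve 1 (λ b → con 1ℚ :* (b :* con 0ℚ) := con 0ℚ) refl (binom 0 k))
           (sum-cong-≗ {m} (pascal-term ∘ toℕ)) ⟩
    0ℚ + ∑[ j < m ] (s * (term c j + term₁ j))
      ≡⟨ ℚ.+-identityˡ _ ⟩
    ∑[ j < m ] (s * (term c j + term₁ j))
      ≡⟨ *-distribˡ-sum {m} s (λ j → term c j + term₁ j) ⟨
    s * ∑[ j < m ] (term c j + term₁ j)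
      ≡⟨ cong (s *_) (∑-distrib-+ {m} (term c) term₁) ⟩
    s * (substitute s m c k + ∑[ j < m ] term₁ j)
      ≡⟨ cong (λ x → s * (substitute s m c k + x)) (sum-shift k) ⟩
    s * (substitute s m c k + shift (substitute s m c) k) ∎
    where
    term₁ : Fin m → ℚ
    term₁ j = (s ^ℚ toℕ j) * (shift (binom (toℕ j)) k * c (toℕ j))

-- A product of n linear factors has degree at most n, so `n < m` makes the m-term sum complete.
-- Each factor u + v t turns into (u + v s) + v s t, again linear, which keeps the result within
-- `∏`.
substitute-∏ : ∀ s u v n m → n < m →
  substitute s m (∏ u v n) ≗ ∏ (λ i → u i + v i * s) (λ i → v i * s) n
substitute-∏ s u v zero (suc m) _ k = begin
  1ℚ * (binom 0 k * 1ℚ) + ∑[ j < m ] ((s ^ℚ suc (toℕ j)) * (binom (suc (toℕ j)) k * 0ℚ))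
    ≡⟨ cong₂ _+_ (solve 1 (λ b → con 1ℚ :* (b :* con 1ℚ) := b) refl (binom 0 k))
         (sum-cong-≗ {m} λ j → solve 2 (λ a b → a :* (b :* con 0ℚ) := con 0ℚ) refl
           (s ^ℚ suc (toℕ j)) (binom (suc (toℕ j)) k)) ⟩
  binom 0 k + ∑[ j < m ] 0ℚ
    ≡⟨ cong₂ _+_ (binom-0 k) (sum-replicate-zero m) ⟩
  δ k + 0ℚ
    ≡⟨ ℚ.+-identityʳ (δ k) ⟩
  δ k ∎
  where
  open ≡-Reasoning
  open ℚ.+-*-Solver
  binom-0 : binom 0 ≗ δ
  binom-0 zero    = refl
  binom-0 (suc k) = refl
substitute-∏ s u v (suc n) (suc m) (s≤s n<m) k = begin
  substitute s (suc m) (linear (u n) (v n) (∏ u v n)) k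
    ≡⟨ substitute-linear s m (u n) (v n) (∏ u v n) k ⟩
  u n * substitute s (suc m) (∏ u v n) k
    + v n * s * (substitute s m (∏ u v n) k + shift (substitute s m (∏ u v n)) k)
    ≡⟨ cong₂ (λ x y → u n * x + v n * s * y)
         (substitute-∏ s u v n (suc m) (ℕ.m<n⇒m<1+n n<m) k)
         (cong₂ _+_ (ih k) (shift-cong ih k)) ⟩
  u n * c k + v n * s * (c k + shift c k)
    ≡⟨ solve 4 (λ u w x y → u :* x :+ w :* (x :+ y) := (u :+ w) :* x :+ w :* y) refl
         (u n) (v n * s) (c k) (shift c k) ⟩
  linear (u n + v n * s) (v n * s) c k ∎
  where
  open ≡-Reasoning
  open ℚ.+-*-Solver
  c = ∏ (λ i → u i + v i * s) (λ i → v i * s) n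
  ih = substitute-∏ s u v n m n<m

-- The polynomials ∏ (1 + t / i) and ∏ (1 + p t / i)

∑-split : ∀ m n (f : ℕ → ℚ) →
  ∑[ i < m ℕ.+ n ] f (toℕ i) ≡ ∑[ i < m ] f (toℕ i) + ∑[ i < n ] f (m ℕ.+ toℕ i)
∑-split zero    n f = sym (ℚ.+-identityˡ (∑[ i < n ] f (toℕ i)))
∑-split (suc m) n f = trans
  (cong (λ x → f 0 + x) (∑-split m n (f ∘ suc)))
  (sym (ℚ.+-assoc (f 0) (∑[ i < m ] f (suc (toℕ i))) (∑[ i < n ] f (suc m ℕ.+ toℕ i))))

-- The absorption identity, by Pascal's rule on both sides. It shows that n + 1 divides (k + 1) (n +
-- 1 C k + 1), to which Euclid's lemma applies when n + 1 is a prime greater than k + 1.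
[k+1]*[n+1]C[k+1]≡[n+1]*nCk : ∀ n k → suc k ℕ.* (suc n C suc k) ≡ suc n ℕ.* (n C k)
[k+1]*[n+1]C[k+1]≡[n+1]*nCk zero zero    = refl
[k+1]*[n+1]C[k+1]≡[n+1]*nCk zero (suc k) = trans
  (cong (suc (suc k) ℕ.*_) (k>n⇒nCk≡0 {k = suc (suc k)} (s≤s (s≤s z≤n))))
  (ℕ.*-zeroʳ (suc (suc k)))
[k+1]*[n+1]C[k+1]≡[n+1]*nCk (suc n) zero = begin
  1 ℕ.* (suc (suc n) C 1)     ≡⟨ ℕ.*-identityˡ _ ⟩
  suc (suc n) C 1             ≡⟨ nC1≡n (suc (suc n)) ⟩
  suc (suc n)                 ≡⟨ ℕ.*-identityʳ _ ⟨
  suc (suc n) ℕ.* 1           ∎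
  where open ≡-Reasoning
[k+1]*[n+1]C[k+1]≡[n+1]*nCk (suc n) (suc k) = begin
  suc (suc k) ℕ.* (suc (suc n) C suc (suc k))
    ≡⟨ cong (suc (suc k) ℕ.*_) (nCk+nC[k+1]≡[n+1]C[k+1] (suc n) (suc k)) ⟨
  suc (suc k) ℕ.* (a ℕ.+ b)
    ≡⟨ solve 3 (λ k a b → (con 2 :+ k) :* (a :+ b) := a :+ ((con 1 :+ k) :* a :+ (con 2 :+ k) :* b)) refl k a b ⟩
  a ℕ.+ (suc k ℕ.* a ℕ.+ suc (suc k) ℕ.* b)
    ≡⟨ cong (a ℕ.+_) (cong₂ ℕ._+_ ([k+1]*[n+1]C[k+1]≡[n+1]*nCk n k) ([k+1]*[n+1]C[k+1]≡[n+1]*nCk n (suc k))) ⟩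
  a ℕ.+ (suc n ℕ.* (n C k) ℕ.+ suc n ℕ.* (n C suc k))
    ≡⟨ cong (a ℕ.+_) (ℕ.*-distribˡ-+ (suc n) (n C k) (n C suc k)) ⟨
  a ℕ.+ suc n ℕ.* (n C k ℕ.+ n C suc k)
    ≡⟨ cong (λ x → a ℕ.+ suc n ℕ.* x) (nCk+nC[k+1]≡[n+1]C[k+1] n k) ⟩
  suc (suc n) ℕ.* a ∎
  where
  open ≡-Reasoning
  open ℕ.+-*-Solver
  a = suc n C suc k
  b = suc n C suc (suc k)

prime∣pC[k+1] : ∀ {n k} → Prime (suc n) → suc k < suc n → suc n ∣ suc n C suc k
prime∣pC[k+1] {n} {k} p-prime k<n =
  [ (λ p∣k → contradiction (∣⇒≤ p∣k) (ℕ.<⇒≱ k<n)) , (λ p∣C → p∣C) ]′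
  (euclidsLemma (suc k) (suc n C suc k) p-prime
    (divides (n C k) (trans ([k+1]*[n+1]C[k+1]≡[n+1]*nCk n k) (ℕ.*-comm (suc n) (n C k)))))

[n+1]Cn≡n+1 : ∀ n → suc n C n ≡ suc n
[n+1]Cn≡n+1 n = trans (nCk≡nC[n∸k] (ℕ.n≤1+n n))
  (trans (cong (suc n C_) (trans (ℕ.+-∸-assoc 1 (ℕ.≤-refl {n})) (cong suc (ℕ.n∸n≡0 n)))) (nC1≡n (suc n)))

1^ : ∀ j → 1ℚ ^ℚ j ≡ 1ℚ
1^ zero    = refl
1^ (suc j) = trans (ℚ.*-identityˡ (1ℚ ^ℚ j)) (1^ j)

inv : ℕ → ℚ
inv i = + 1 / suc i

one : ℕ → ℚ
one _ = 1ℚ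

inv-* : ∀ i → inv i * ι (+ suc i) ≡ 1ℚ
inv-* i = /-*-cancel (+ 1) (suc i)

-- Q n is (1 + t) (1 + t/2) ⋯ (1 + t/n).
Q : ℕ → ℕ → ℚ
Q = ∏ one inv

-- (1 + t) Qₙ(1 + t) = (n + 1 + t) Qₙ(t)
Q-translate : ∀ n →
  linear 1ℚ 1ℚ (∏ (λ i → 1ℚ + inv i * 1ℚ) (λ i → inv i * 1ℚ) n) ≗ linear (ι (+ suc n)) 1ℚ (Q n)
Q-translate zero    k = refl
-- Telescoping: the new factor 1 + (1 + t)/(n + 1) equals (n + 2 + t)/(n + 1), and its denominator
-- turns the n + 1 + t of the induction hypothesis into the missing factor 1 + t/(n + 1).
Q-translate (suc n) k = begin
  linear 1ℚ 1ℚ (linear a b (∏ (λ i → 1ℚ + inv i * 1ℚ) (λ i → inv i * 1ℚ) n)) k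
    ≡⟨ linear-comm 1ℚ 1ℚ a b (∏ (λ i → 1ℚ + inv i * 1ℚ) (λ i → inv i * 1ℚ) n) k ⟩
  linear a b (linear 1ℚ 1ℚ (∏ (λ i → 1ℚ + inv i * 1ℚ) (λ i → inv i * 1ℚ) n)) k
    ≡⟨ linear-cong a b (Q-translate n) k ⟩
  a * (N * y₀ + 1ℚ * y₁) + b * shift (linear N 1ℚ (Q n)) k
    ≡⟨ cong (λ x → a * (N * y₀ + 1ℚ * y₁) + b * x) (shift-linear N 1ℚ (Q n) k) ⟩
  a * (N * y₀ + 1ℚ * y₁) + b * (N * y₁ + 1ℚ * y₂)
    ≡⟨ solve 5 (λ r N y₀ y₁ y₂ →
         (con 1ℚ :+ r :* con 1ℚ) :* (N :* y₀ :+ con 1ℚ :* y₁) :+ r :* con 1ℚ :* (N :* y₁ :+ con 1ℚ :* y₂) :=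
         (r :* N) :* y₀ :+ (N :* y₀ :+ y₁ :+ r :* (N :* y₁ :+ y₁ :+ y₂))) refl (inv n) N y₀ y₁ y₂ ⟩
  inv n * N * y₀ + (N * y₀ + y₁ + inv n * (N * y₁ + y₁ + y₂))
    ≡⟨ cong (λ x → x * y₀ + (N * y₀ + y₁ + inv n * (N * y₁ + y₁ + y₂))) (inv-* n) ⟩
  1ℚ * y₀ + (N * y₀ + y₁ + inv n * (N * y₁ + y₁ + y₂))
    ≡⟨ solve 5 (λ r N y₀ y₁ y₂ →
         con 1ℚ :* y₀ :+ (N :* y₀ :+ y₁ :+ r :* (N :* y₁ :+ y₁ :+ y₂)) :=
         (con 1ℚ :+ N) :* (con 1ℚ :* y₀ :+ r :* y₁) :+ con 1ℚ :* (con 1ℚ :* y₁ :+ r :* y₂)) refl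
         (inv n) N y₀ y₁ y₂ ⟩
  (1ℚ + N) * (1ℚ * y₀ + inv n * y₁) + 1ℚ * (1ℚ * y₁ + inv n * y₂)
    ≡⟨ cong₂ (λ x y → x * (1ℚ * y₀ + inv n * y₁) + 1ℚ * y)
         (ι-+ (+ 1) (+ suc n)) (shift-linear 1ℚ (inv n) (Q n) k) ⟨
  linear (ι (+ suc (suc n))) 1ℚ (linear 1ℚ (inv n) (Q n)) k ∎
  where
  open ≡-Reasoning
  open ℚ.+-*-Solver
  a = 1ℚ + inv n * 1ℚ
  b = inv n * 1ℚ
  N = ι (+ suc n)
  y₀ = Q n k
  y₁ = shift (Q n) k
  y₂ = shift (shift (Q n)) k

-- Compare the coefficients of t^(k+1) in `Q-translate`. On the left, multiplication by 1 + t raises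
-- the upper index of the binomials by Pascal's rule. The isolated Q n k on the right will cancel
-- the term j = k on the left.
Q-recurrence : ∀ n k →
  ∑[ j < suc n ] (binom (suc (toℕ j)) (suc k) * Q n (toℕ j)) ≡ ι (+ suc n) * Q n (suc k) + Q n k
Q-recurrence n k = begin
  ∑[ j < suc n ] (binom (suc (toℕ j)) (suc k) * Q n (toℕ j))
    ≡⟨ sum-cong-≗ {suc n} (λ j → pascal-term (toℕ j)) ⟩
  ∑[ j < suc n ] ((1ℚ ^ℚ toℕ j) * (binom (toℕ j) (suc k) * Q n (toℕ j))
                      + (1ℚ ^ℚ toℕ j) * (binom (toℕ j) k * Q n (toℕ j)))
    ≡⟨ ∑-distrib-+ {suc n} (λ j → (1ℚ ^ℚ toℕ j) * (binom (toℕ j) (suc k) * Q n (toℕ j)))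
                             (λ j → (1ℚ ^ℚ toℕ j) * (binom (toℕ j) k * Q n (toℕ j))) ⟩
  S (suc k) + S k
    ≡⟨ cong₂ _+_ (substitute-∏ 1ℚ one inv n (suc n) ℕ.≤-refl (suc k))
                  (substitute-∏ 1ℚ one inv n (suc n) ℕ.≤-refl k) ⟩
  R (suc k) + R k
    ≡⟨ cong₂ _+_ (ℚ.*-identityˡ (R (suc k))) (ℚ.*-identityˡ (R k)) ⟨
  linear 1ℚ 1ℚ R (suc k)
    ≡⟨ Q-translate n (suc k) ⟩
  ι (+ suc n) * Q n (suc k) + 1ℚ * Q n k
    ≡⟨ cong (λ x → ι (+ suc n) * Q n (suc k) + x) (ℚ.*-identityˡ (Q n k)) ⟩
  ι (+ suc n) * Q n (suc k) + Q n k ∎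
  where
  open ≡-Reasoning
  open ℚ.+-*-Solver
  S = substitute 1ℚ (suc n) (Q n)
  R = ∏ (λ i → 1ℚ + inv i * 1ℚ) (λ i → inv i * 1ℚ) n
  pascal-term : ∀ j → binom (suc j) (suc k) * Q n j ≡
    (1ℚ ^ℚ j) * (binom j (suc k) * Q n j) + (1ℚ ^ℚ j) * (binom j k * Q n j)
  pascal-term j = trans (cong (_* Q n j) (binom-suc j (suc k))) (trans
    (solve 3 (λ a b x → (a :+ b) :* x := con 1ℚ :* (a :* x) :+ con 1ℚ :* (b :* x)) refl
      (binom j (suc k)) (binom j k) (Q n j))
    (cong (λ w → w * (binom j (suc k) * Q n j) + w * (binom j k * Q n j)) (sym (1^ j))))

-- In Q-recurrence the terms with j < k vanish, and the one with j = k is Q n k.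
Q-leading : ∀ n k r → k ℕ.+ suc (suc r) ≡ suc n →
  ι (+ suc (suc k)) * Q n (suc k) ≡ ι (+ suc n) * Q n (suc k)
    + - ∑[ i < r ] (binom (suc (k ℕ.+ suc (suc (toℕ i)))) (suc k) * Q n (k ℕ.+ suc (suc (toℕ i))))
Q-leading n k r eq = solve-for
  (ι (+ suc (suc k)) * Q n (suc k)) (Q n k) tail (ι (+ suc n) * Q n (suc k)) (begin
  ι (+ suc (suc k)) * Q n (suc k) + Q n k + tail
    ≡⟨ solve 3 (λ a b c → a :+ b :+ c := con 0ℚ :+ (b :+ (a :+ c))) refl
         (ι (+ suc (suc k)) * Q n (suc k)) (Q n k) tail ⟩
  0ℚ + (Q n k + (ι (+ suc (suc k)) * Q n (suc k) + tail))
    ≡⟨ cong₂ _+_ (trans (sum-cong-≗ {k} low) (sum-replicate-zero k))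
                  (cong₂ (λ x y → x + (y + tail)) at-k at-k+1) ⟨
  ∑[ j < k ] term (toℕ j) + (term (k ℕ.+ 0) + (term (k ℕ.+ 1) + tail))
    ≡⟨ ∑-split k (suc (suc r)) term ⟨
  ∑[ j < k ℕ.+ suc (suc r) ] term (toℕ j)
    ≡⟨ cong (λ m → ∑[ j < m ] term (toℕ j)) eq ⟩
  ∑[ j < suc n ] term (toℕ j)
    ≡⟨ Q-recurrence n k ⟩
  ι (+ suc n) * Q n (suc k) + Q n k ∎)
  where
  open ≡-Reasoning
  open ℚ.+-*-Solver
  term : ℕ → ℚ
  term j = binom (suc j) (suc k) * Q n j
  tail = ∑[ i < r ] term (k ℕ.+ suc (suc (toℕ i)))
  low : ∀ j → term (toℕ j) ≡ 0ℚ
  low j = trans (cong (λ m → ι (+ m) * Q n (toℕ j)) (k>n⇒nCk≡0 (s≤s (toℕ<n j)))) (ℚ.*-zeroˡ (Q n (toℕ j)))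
  at-k : term (k ℕ.+ 0) ≡ Q n k
  at-k = trans (cong term (ℕ.+-identityʳ k))
    (trans (cong (λ m → ι (+ m) * Q n k) (nCn≡1 (suc k))) (ℚ.*-identityˡ (Q n k)))
  at-k+1 : term (k ℕ.+ 1) ≡ ι (+ suc (suc k)) * Q n (suc k)
  at-k+1 = trans (cong term (ℕ.+-comm k 1)) (cong (λ m → ι (+ m) * Q n (suc k)) ([n+1]Cn≡n+1 (suc k)))
  solve-for : ∀ a b c d → a + b + c ≡ d + b → a ≡ d + - c
  solve-for a b c d h = trans
    (solve 3 (λ a b c → a := (a :+ b :+ c) :+ (:- b :+ :- c)) refl a b c) (trans
    (cong (λ x → x + (- b + - c)) h)
    (solve 3 (λ b c d → d :+ b :+ (:- b :+ :- c) := d :+ :- c) refl b c d))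

-- The reflection t ↦ -1 - t

-1ℚ : ℚ
-1ℚ = - 1ℚ

-1^even : ∀ {n} → 2 ∣ n → -1ℚ ^ℚ n ≡ 1ℚ
-1^even (divides q refl) = go q
  where
  open ℚ.+-*-Solver
  go : ∀ q → -1ℚ ^ℚ (q ℕ.* 2) ≡ 1ℚ
  go zero    = refl
  go (suc q) = trans (solve 1 (λ x → con -1ℚ :* (con -1ℚ :* x) := x) refl (-1ℚ ^ℚ (q ℕ.* 2))) (go q)

product-neg : ∀ a n → product (λ i → a i * -1ℚ) n ≡ -1ℚ ^ℚ n * product a n
product-neg a zero    = refl
product-neg a (suc n) = trans (cong (λ x → a n * -1ℚ * x) (product-neg a n))
  (solve 4 (λ a m b c → a :* m :* (b :* c) := m :* b :* (a :* c)) refl (a n) -1ℚ (-1ℚ ^ℚ n) (product a n))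
  where open ℚ.+-*-Solver

-- E n is (1 + p t) (1 + p t/2) ⋯ (1 + p t/n) for p = n + 1.
E : ℕ → ℕ → ℚ
E n = ∏ one (λ i → ι (+ suc n) * inv i) n

-- The reflection t ↦ -1 - t turns the factor of index i into a multiple of the
-- one of index p - i.
E-reflect : ∀ {n} → 2 ∣ n → substitute -1ℚ (suc n) (E n) ≗ E n
E-reflect {n} 2∣n k = begin
  substitute -1ℚ (suc n) (E n) k
    ≡⟨ substitute-∏ -1ℚ one (λ i → p * inv i) n (suc n) ℕ.≤-refl k ⟩
  ∏ (λ i → 1ℚ + p * inv i * -1ℚ) (λ i → p * inv i * -1ℚ) n k
    ≡⟨ ∏-cong n (λ {i} _ → reflect-const i)
         (λ {i} _ → solve 2 (λ p r → p :* r :* con -1ℚ := r :* con -1ℚ :* p) refl p (inv i)) k ⟩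
  ∏ (λ i → inv i * -1ℚ * (p + - ι (+ suc i))) (λ i → inv i * -1ℚ * p) n k
    ≡⟨ ∏-scale (λ i → inv i * -1ℚ) (λ i → p + - ι (+ suc i)) (λ _ → p) n k ⟩
  product (λ i → inv i * -1ℚ) n * ∏ (λ i → p + - ι (+ suc i)) (λ _ → p) n k
    -- Extracting -1/i leaves p - i + p t. The p - 1 signs cancel because p - 1 is even, and reading
    -- the factors backwards gives i + p t. The product of the 1/i that remains is just what
    -- restores 1 + p t/i.
    ≡⟨ cong₂ _*_
         (trans (product-neg inv n)
           (trans (cong (_* product inv n) (-1^even 2∣n)) (ℚ.*-identityˡ (product inv n))))
         (trans (∏-reverse (λ i → p + - ι (+ suc i)) (λ _ → p) n k)
                (∏-cong n reversed (λ _ → refl) k)) ⟩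
  product inv n * ∏ (λ i → ι (+ suc i)) (λ _ → p) n k
    ≡⟨ ∏-scale inv (λ i → ι (+ suc i)) (λ _ → p) n k ⟨
  ∏ (λ i → inv i * ι (+ suc i)) (λ i → inv i * p) n k
    ≡⟨ ∏-cong n (λ {i} _ → inv-* i) (λ {i} _ → ℚ.*-comm (inv i) p) k ⟩
  E n k ∎
  where
  open ≡-Reasoning
  open ℚ.+-*-Solver
  p = ι (+ suc n)
  reflect-const : ∀ i → 1ℚ + p * inv i * -1ℚ ≡ inv i * -1ℚ * (p + - ι (+ suc i))
  reflect-const i = trans (cong (λ x → x + p * inv i * -1ℚ) (sym (inv-* i)))
    (solve 3 (λ p r s → r :* s :+ p :* r :* con -1ℚ := r :* con -1ℚ :* (p :+ :- s)) refl
      p (inv i) (ι (+ suc i)))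
  reversed : ∀ {i} → i < n → p + - ι (+ suc (n ℕ.∸ suc i)) ≡ ι (+ suc i)
  reversed {i} i<n = trans
    (cong (λ m → ι (+ suc m) + - ι (+ suc (n ℕ.∸ suc i))) (sym (ℕ.m+[n∸m]≡n i<n))) (trans
    (cong (λ x → x + - c) (trans
      (cong (λ m → ι (+ m)) (sym (ℕ.+-suc (suc i) (n ℕ.∸ suc i))))
      (ι-+ (+ suc i) (+ suc (n ℕ.∸ suc i)))))
    (solve 2 (λ x y → x :+ y :+ :- y := x) refl (ι (+ suc i)) c))
    where c = ι (+ suc (n ℕ.∸ suc i))

2∣n⊎2∣1+n : ∀ n → 2 ∣ n ⊎ 2 ∣ suc n
2∣n⊎2∣1+n zero    = inj₁ (divides 0 refl)
2∣n⊎2∣1+n (suc n) with 2∣n⊎2∣1+n n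
... | inj₁ (divides q refl) = inj₂ (divides (suc q) refl)
... | inj₂ 2∣1+n            = inj₁ 2∣1+n

odd-prime : ∀ {n} → Prime (suc n) → 2 ≤ n → 2 ∣ n
odd-prime {n} p-prime 2≤n with 2∣n⊎2∣1+n n
... | inj₁ 2∣n   = 2∣n
... | inj₂ 2∣1+n with prime⇒irreducible p-prime 2∣1+n
...   | inj₁ ()
...   | inj₂ refl = contradiction 2≤n ℕ.1+n≰n

-- Divisibility of the coefficients of Q and E by powers of p

module OddPrime {n : ℕ} (p-prime : Prime (suc n)) where

  open Localization p-prime public

  ∏-integral : ∀ m {u v} → (∀ {i} → i < m → Integral (u i)) → (∀ {i} → i < m → Integral (v i)) →
               ∀ k → Integral (∏ u v m k)
  ∏-integral zero    u∈ v∈ zero    = ∈ℤ-ι (+ 1)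
  ∏-integral zero    u∈ v∈ (suc k) = ∈ℤ-ι (+ 0)
  ∏-integral (suc m) u∈ v∈ k = ∈ℤ-+ (∈ℤ-* (u∈ ℕ.≤-refl) (ih k)) (∈ℤ-* (v∈ ℕ.≤-refl) (shifted k))
    where
    ih = ∏-integral m (u∈ ∘ ℕ.m<n⇒m<1+n) (v∈ ∘ ℕ.m<n⇒m<1+n)
    shifted : ∀ k → Integral (shift (∏ _ _ m) k)
    shifted zero    = ∈ℤ-ι (+ 0)
    shifted (suc k) = ih k

  Q-integral : ∀ k → Integral (Q n k)
  Q-integral = ∏-integral n (λ _ → ∈ℤ-ι (+ 1))
    (λ i<n → ∈ℤ-/ (+ 1) _ (λ p∣i → ℕ.<⇒≱ (s≤s i<n) (∣⇒≤ p∣i)))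

  p∈p^1 : ι (+ suc n) ∈p^ 1
  p∈p^1 = subst (_∈p^ 1) P^1 (p^∈p^ 1)

  ∣⇒∈p^1 : ∀ {m} → suc n ∣ m → ι (+ m) ∈p^ 1
  ∣⇒∈p^1 (divides q refl) = subst (_∈p^ 1)
    (trans (sym (ι-* (+ q) (+ suc n))) (cong ι (sym (ℤ.pos-* q (suc n)))))
    (∈p^-*ˡ (∈ℤ-ι (+ q)) p∈p^1)

  -- In `Q-leading` the factor k + 2 on the left is less than p, hence invertible. On the right, p Q
  -- n (suc k) is visibly divisible by p, and the remaining terms have larger indices.
  Q∈p^1 : ∀ k → suc k < n → Q n (suc k) ∈p^ 1
  Q∈p^1 k k<n = go n k k<n (ℕ.m≤n+m n (suc k))
    where
    -- The descent in k is recursion on r, a bound for the distance from k + 1 up to n.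
    go : ∀ r k → suc k < n → n ≤ suc k ℕ.+ r → Q n (suc k) ∈p^ 1
    go zero    k k<n n≤k = contradiction (subst (n ≤_) (ℕ.+-identityʳ (suc k)) n≤k) (ℕ.<⇒≱ k<n)
    go (suc r) k k<n n≤k+r = ∈p^-cancel (suc (suc k)) (λ p∣ → ℕ.<⇒≱ (s≤s k<n) (∣⇒≤ p∣))
      (subst (_∈p^ 1) (sym (Q-leading n k s k+s≡n))
        (∈p^-+ (∈p^-*ʳ p∈p^1 (Q-integral (suc k))) (∈p^-neg (∈p^-∑ s _ (λ i → term∈ (toℕ i) (toℕ<n i))))))
      where
      s = n ℕ.∸ suc k
      k+s≡n : k ℕ.+ suc (suc s) ≡ suc n
      k+s≡n = trans (ℕ.+-suc k (suc s)) (cong suc (trans (ℕ.+-suc k s) (ℕ.m+[n∸m]≡n (ℕ.<⇒≤ k<n))))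
      term∈ : ∀ i → i < s → binom (suc (k ℕ.+ suc (suc i))) (suc k) * Q n (k ℕ.+ suc (suc i)) ∈p^ 1
      term∈ i i<s = subst (λ j → binom (suc j) (suc k) * Q n j ∈p^ 1) (sym (ℕ.+-suc k (suc i))) index
        where
        j = k ℕ.+ suc i
        j<n : suc j ≤ n
        j<n = ℕ.s≤s⁻¹ (ℕ.≤-trans
          (ℕ.≤-reflexive (sym (trans (ℕ.+-suc k (suc (suc i))) (cong suc (ℕ.+-suc k (suc i))))))
          (ℕ.≤-trans (ℕ.+-monoʳ-≤ k (s≤s (s≤s i<s))) (ℕ.≤-reflexive k+s≡n)))
        index : binom (suc (suc j)) (suc k) * Q n (suc j) ∈p^ 1
        index with ℕ.m≤n⇒m<n∨m≡n j<n
        ... | inj₁ j+1<n = ∈p^-*ˡ (∈ℤ-ι (+ (suc (suc j) C suc k))) (go r j j+1<n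
          (ℕ.≤-trans n≤k+r (ℕ.≤-trans (ℕ.≤-reflexive (ℕ.+-suc (suc k) r))
            (s≤s (ℕ.+-monoˡ-≤ r (ℕ.≤-trans (s≤s (ℕ.m≤m+n k i)) (ℕ.≤-reflexive (sym (ℕ.+-suc k i)))))))))
        -- The unit Q n n has no factor p to offer, but its binomial is (p C k + 1) with 0 < k + 1 <
        -- p.
        ... | inj₂ j+1≡n = ∈p^-*ʳ
          (subst (λ m → binom (suc m) (suc k) ∈p^ 1) (sym j+1≡n)
            (∣⇒∈p^1 (prime∣pC[k+1] p-prime (ℕ.m<n⇒m<1+n k<n))))
          (Q-integral (suc j))

  p^j∈p^ : ∀ j → (ι (+ suc n) ^ℚ j) ∈p^ j
  p^j∈p^ zero    = p^∈p^ 0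
  p^j∈p^ (suc j) = ∈p^-* p∈p^1 (p^j∈p^ j)

  E≡p^*Q : ∀ k → E n k ≡ (ι (+ suc n) ^ℚ k) * Q n k
  E≡p^*Q = ∏-dilate (ι (+ suc n)) one inv n

  E∈p^ : ∀ k → E n k ∈p^ k
  E∈p^ k = subst (_∈p^ k) (sym (E≡p^*Q k)) (∈p^-*ʳ (p^j∈p^ k) (Q-integral k))

  E∈p^[k+1] : ∀ k → 1 ≤ k → k < n → E n k ∈p^ (k ℕ.+ 1)
  E∈p^[k+1] (suc k) _ k<n = subst (_∈p^ (suc k ℕ.+ 1)) (sym (E≡p^*Q (suc k)))
    (∈p^-* (p^j∈p^ (suc k)) (Q∈p^1 k k<n))

  -- By `E-reflect`, E n k is the full sum of p terms, so subtracting its first m terms leaves the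
  -- indices j ≥ m. For this the truncation must be an initial segment, hence `m ≤ suc n`; `2 ≤ n`
  -- excludes p = 2, where the sign in the reflection is wrong.
  E-truncated : 2 ≤ n → ∀ m → m ≤ suc n → ∀ k →
    E n k + - ∑[ j < m ] ((-1ℚ ^ℚ toℕ j) * (binom (toℕ j) k * E n (toℕ j))) ∈p^ m
  E-truncated 2≤n m m≤p k = subst (_∈p^ m) (sym (begin
    E n k + - head
      ≡⟨ cong (λ x → x + - head) (E-reflect (odd-prime p-prime 2≤n) k) ⟨
    ∑[ j < suc n ] term (toℕ j) + - head
      ≡⟨ cong (λ l → ∑[ j < l ] term (toℕ j) + - head) (ℕ.m+[n∸m]≡n m≤p) ⟨
    ∑[ j < m ℕ.+ (suc n ℕ.∸ m) ] term (toℕ j) + - head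
      ≡⟨ cong (λ x → x + - head) (∑-split m (suc n ℕ.∸ m) term) ⟩
    head + tail + - head
      ≡⟨ solve 2 (λ a b → a :+ b :+ :- a := b) refl head tail ⟩
    tail ∎))
    (∈p^-∑ (suc n ℕ.∸ m) _ (λ i →
      ∈p^-*ˡ (∈ℤ-^ (m ℕ.+ toℕ i) (∈ℤ-ι (ℤ.- (+ 1)))) (∈p^-*ˡ (∈ℤ-ι (+ ((m ℕ.+ toℕ i) C k)))
        (∈p^-≤ (ℕ.m≤m+n m (toℕ i)) (E∈p^ (m ℕ.+ toℕ i))))))
    where
    open ≡-Reasoning
    open ℚ.+-*-Solver
    term : ℕ → ℚ
    term j = (-1ℚ ^ℚ j) * (binom j k * E n j)
    head = ∑[ j < m ] term (toℕ j)
    tail = ∑[ i < suc n ℕ.∸ m ] term (m ℕ.+ toℕ i)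

-- Evaluation of symmetric functions

VanishesAbove : ℕ → Series → Set
VanishesAbove d f = ∀ α → d < sum α → f α ≡ 0ℚ

∑-zero : ∀ n {t : Fin n → ℚ} → (∀ i → t i ≡ 0ℚ) → ∑[ i < n ] t i ≡ 0ℚ
∑-zero n t≡0 = trans (sum-cong-≗ {n} t≡0) (sum-replicate-zero n)

∑-truncate : ∀ {d D} (t : ℕ → ℚ) → (∀ a → d < a → t a ≡ 0ℚ) → d ≤ D →
  ∑[ a ≤ D ] t (toℕ a) ≡ ∑[ a ≤ d ] t (toℕ a)
∑-truncate {d} {D} t t≡0 d≤D = begin
  ∑[ a ≤ D ] t (toℕ a)
    ≡⟨ cong (λ n → ∑[ a ≤ n ] t (toℕ a)) (ℕ.m+[n∸m]≡n d≤D) ⟨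
  ∑[ a ≤ d ℕ.+ r ] t (toℕ a)
    ≡⟨ ∑-split (suc d) r t ⟩
  ∑[ a ≤ d ] t (toℕ a) + ∑[ i < r ] t (suc d ℕ.+ toℕ i)
    ≡⟨ cong (λ x → ∑[ a ≤ d ] t (toℕ a) + x) (∑-zero r (λ i → t≡0 _ (s≤s (ℕ.m≤m+n d (toℕ i))))) ⟩
  ∑[ a ≤ d ] t (toℕ a) + 0ℚ
    ≡⟨ ℚ.+-identityʳ _ ⟩
  ∑[ a ≤ d ] t (toℕ a) ∎
  where
  open ≡-Reasoning
  r = D ℕ.∸ d

-- The triangle i + j ≤ D may replace the square because s i t j vanishes outside it, by
-- `d + d′ ≤ D`. The proof splits off the row i = 0 and shifts s, which lowers d and D together.
∑-convolution : ∀ d {d′ D} (s t : ℕ → ℚ) →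
  (∀ i → d < i → s i ≡ 0ℚ) → (∀ j → d′ < j → t j ≡ 0ℚ) → d ℕ.+ d′ ≤ D →
  ∑[ a ≤ D ] ∑[ i ≤ toℕ a ] (s (toℕ i) * t (toℕ a ℕ.∸ toℕ i)) ≡
  ∑[ i ≤ D ] s (toℕ i) * ∑[ j ≤ D ] t (toℕ j)
∑-convolution d {d′} {D} s t s≡0 t≡0 d+d′≤D = begin
  ∑[ a ≤ D ] (s 0 * t (toℕ a) + later (toℕ a))
    ≡⟨ ∑-distrib-+ {suc D} (λ a → s 0 * t (toℕ a)) (later ∘ toℕ) ⟩
  ∑[ a ≤ D ] (s 0 * t (toℕ a)) + ∑[ a ≤ D ] later (toℕ a)
    ≡⟨ cong₂ _+_ (sym (*-distribˡ-sum {suc D} (s 0) (t ∘ toℕ))) (rest d s≡0 d+d′≤D) ⟩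
  s 0 * ∑[ j ≤ D ] t (toℕ j) + ∑[ i < D ] s (suc (toℕ i)) * ∑[ j ≤ D ] t (toℕ j)
    ≡⟨ ℚ.*-distribʳ-+ (∑[ j ≤ D ] t (toℕ j)) (s 0) (∑[ i < D ] s (suc (toℕ i))) ⟨
  ∑[ i ≤ D ] s (toℕ i) * ∑[ j ≤ D ] t (toℕ j) ∎
  where
  open ≡-Reasoning
  later : ℕ → ℚ
  later a = ∑[ i < a ] (s (suc (toℕ i)) * t (a ℕ.∸ suc (toℕ i)))
  rest : ∀ d {D} → (∀ i → d < i → s i ≡ 0ℚ) → d ℕ.+ d′ ≤ D →
    ∑[ a ≤ D ] later (toℕ a) ≡ ∑[ i < D ] s (suc (toℕ i)) * ∑[ j ≤ D ] t (toℕ j)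
  rest zero {D} s≡0 _ = begin
    ∑[ a ≤ D ] later (toℕ a)
      ≡⟨ ∑-zero (suc D) (λ a → ∑-zero (toℕ a) (λ i →
           trans (cong (_* t (toℕ a ℕ.∸ suc (toℕ i))) (s≡0 (suc (toℕ i)) (s≤s z≤n)))
             (ℚ.*-zeroˡ (t (toℕ a ℕ.∸ suc (toℕ i)))))) ⟩
    0ℚ
      ≡⟨ ℚ.*-zeroˡ (∑[ j ≤ D ] t (toℕ j)) ⟨
    0ℚ * ∑[ j ≤ D ] t (toℕ j)
      ≡⟨ cong (_* ∑[ j ≤ D ] t (toℕ j)) (∑-zero D (λ i → s≡0 (suc (toℕ i)) (s≤s z≤n))) ⟨
    ∑[ i < D ] s (suc (toℕ i)) * ∑[ j ≤ D ] t (toℕ j) ∎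
  rest (suc d) {suc D} s≡0 (s≤s d+d′≤D) = begin
    0ℚ + ∑[ a ≤ D ] later (suc (toℕ a))
      ≡⟨ ℚ.+-identityˡ _ ⟩
    ∑[ a ≤ D ] later (suc (toℕ a))
      ≡⟨ ∑-convolution d {d′} {D} (s ∘ suc) t (λ i d<i → s≡0 (suc i) (s≤s d<i)) t≡0 d+d′≤D ⟩
    ∑[ i ≤ D ] s (suc (toℕ i)) * ∑[ j ≤ D ] t (toℕ j)
      -- The shifted problem sums t only up to D; the additional term at D + 1 is zero because d′ ≤
      -- D.
      ≡⟨ cong (λ x → ∑[ i ≤ D ] s (suc (toℕ i)) * x)
           (trans (∑-truncate {D = D} t t≡0 d′≤D)
                  (sym (∑-truncate {D = suc D} t t≡0 (ℕ.m≤n⇒m≤1+n d′≤D)))) ⟩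
    ∑[ i ≤ D ] s (suc (toℕ i)) * ∑[ j ≤ suc D ] t (toℕ j) ∎
    where d′≤D = ℕ.m+n≤o⇒n≤o d d+d′≤D

-- The degree really drops to d - i. Keeping d leaves the hypotheses on the cutoff, such as
-- `d + d′ ≤ D`, unchanged while variables are removed one by one.
section-vanishes : ∀ {d f} i → VanishesAbove d f → VanishesAbove d (section f i)
section-vanishes i f≡0 α d<α = f≡0 (i ∷ α) (ℕ.≤-trans d<α (ℕ.m≤n+m (sum α) i))

section-zero : ∀ {d f} i → VanishesAbove d f → d < i → ∀ α → section f i α ≡ 0ℚ
section-zero i f≡0 d<i α = f≡0 (i ∷ α) (ℕ.≤-trans d<i (ℕ.m≤m+n i (sum α)))

evalUpTo-cong : ∀ d {f g} → (∀ α → f α ≡ g α) → ∀ xs → evalUpTo d f xs ≡ evalUpTo d g xs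
evalUpTo-cong d f≗g []       = f≗g []
evalUpTo-cong d f≗g (x ∷ xs) = sum-cong-≗ {suc d} λ a →
  cong ((x ^ℚ toℕ a) *_) (evalUpTo-cong d (λ α → f≗g (toℕ a ∷ α)) xs)

evalUpTo-zero : ∀ d {f} → (∀ α → f α ≡ 0ℚ) → ∀ xs → evalUpTo d f xs ≡ 0ℚ
evalUpTo-zero d f≡0 []       = f≡0 []
evalUpTo-zero d f≡0 (x ∷ xs) = ∑-zero (suc d) λ a →
  trans (cong ((x ^ℚ toℕ a) *_) (evalUpTo-zero d (λ α → f≡0 (toℕ a ∷ α)) xs)) (ℚ.*-zeroʳ (x ^ℚ toℕ a))

evalUpTo-+ : ∀ d f g xs → evalUpTo d (λ α → f α + g α) xs ≡ evalUpTo d f xs + evalUpTo d g xs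
evalUpTo-+ d f g []       = refl
evalUpTo-+ d f g (x ∷ xs) = trans
  (sum-cong-≗ {suc d} λ a → trans
    (cong ((x ^ℚ toℕ a) *_) (evalUpTo-+ d (section f (toℕ a)) (section g (toℕ a)) xs))
    (ℚ.*-distribˡ-+ (x ^ℚ toℕ a) (evalUpTo d (section f (toℕ a)) xs) (evalUpTo d (section g (toℕ a)) xs)))
  (∑-distrib-+ {suc d} (λ a → (x ^ℚ toℕ a) * evalUpTo d (section f (toℕ a)) xs)
                       (λ a → (x ^ℚ toℕ a) * evalUpTo d (section g (toℕ a)) xs))

evalUpTo-∑ : ∀ d n (f : Fin n → Series) xs →
  evalUpTo d (λ α → ∑[ i < n ] f i α) xs ≡ ∑[ i < n ] evalUpTo d (f i) xs
evalUpTo-∑ d zero    f xs = evalUpTo-zero d (λ _ → refl) xs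
evalUpTo-∑ d (suc n) f xs = trans
  (evalUpTo-+ d (f fzero) (λ α → ∑[ i < n ] f (fsuc i) α) xs)
  (cong (λ y → evalUpTo d (f fzero) xs + y) (evalUpTo-∑ d n (f ∘ fsuc) xs))

evalUpTo-scale : ∀ d q f xs → evalUpTo d (λ α → q * f α) xs ≡ q * evalUpTo d f xs
evalUpTo-scale d q f []       = refl
evalUpTo-scale d q f (x ∷ xs) = trans
  (sum-cong-≗ {suc d} λ a → trans
    (cong ((x ^ℚ toℕ a) *_) (evalUpTo-scale d q (section f (toℕ a)) xs))
    (solve 3 (λ b q y → b :* (q :* y) := q :* (b :* y)) refl (x ^ℚ toℕ a) q (evalUpTo d (section f (toℕ a)) xs)))
  (sym (*-distribˡ-sum {suc d} q (λ a → (x ^ℚ toℕ a) * evalUpTo d (section f (toℕ a)) xs)))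
  where open ℚ.+-*-Solver

-- `bound` is data of the record and not determined by the series: functions equal under `≈` can
-- carry different bounds, and sums and products carry larger ones. This lemma moves them all to one
-- cutoff.
evalUpTo-stable : ∀ {d D f} → VanishesAbove d f → d ≤ D → ∀ xs → evalUpTo D f xs ≡ evalUpTo d f xs
evalUpTo-stable         f≡0 d≤D []       = refl
evalUpTo-stable {d} {D} {f} f≡0 d≤D (x ∷ xs) = trans
  (∑-truncate {D = D} (λ a → (x ^ℚ a) * evalUpTo D (section f a) xs) (λ a d<a → trans
    (cong ((x ^ℚ a) *_) (evalUpTo-zero D (section-zero a f≡0 d<a) xs)) (ℚ.*-zeroʳ (x ^ℚ a))) d≤D)
  (sum-cong-≗ {suc d} λ a → cong ((x ^ℚ toℕ a) *_) (evalUpTo-stable (section-vanishes (toℕ a) f≡0) d≤D xs))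

evalUpTo-⊛ : ∀ {d d′ D f g} → VanishesAbove d f → VanishesAbove d′ g → d ℕ.+ d′ ≤ D → ∀ xs →
  evalUpTo D (f ⊛ g) xs ≡ evalUpTo D f xs * evalUpTo D g xs
evalUpTo-⊛ f≡0 g≡0 d+d′≤D [] = refl
evalUpTo-⊛ {d} {d′} {D} {f} {g} f≡0 g≡0 d+d′≤D (x ∷ xs) = begin
  ∑[ a ≤ D ] ((x ^ℚ toℕ a) * evalUpTo D (section (f ⊛ g) (toℕ a)) xs)
    ≡⟨ sum-cong-≗ {suc D} (λ a → expand (toℕ a)) ⟩
  ∑[ a ≤ D ] ∑[ i ≤ toℕ a ] (s (toℕ i) * t (toℕ a ℕ.∸ toℕ i))
    ≡⟨ ∑-convolution d {d′} {D} s t (vanish f≡0) (vanish g≡0) d+d′≤D ⟩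
  ∑[ a ≤ D ] s (toℕ a) * ∑[ a ≤ D ] t (toℕ a) ∎
  where
  open ≡-Reasoning
  open ℚ.+-*-Solver
  s t : ℕ → ℚ
  s i = (x ^ℚ i) * evalUpTo D (section f i) xs
  t j = (x ^ℚ j) * evalUpTo D (section g j) xs
  vanish : ∀ {d h} → VanishesAbove d h → ∀ i → d < i → (x ^ℚ i) * evalUpTo D (section h i) xs ≡ 0ℚ
  vanish h≡0 i d<i = trans (cong ((x ^ℚ i) *_) (evalUpTo-zero D (section-zero i h≡0 d<i) xs)) (ℚ.*-zeroʳ (x ^ℚ i))
  expand : ∀ a → (x ^ℚ a) * evalUpTo D (section (f ⊛ g) a) xs ≡ ∑[ i ≤ a ] (s (toℕ i) * t (a ℕ.∸ toℕ i))
  expand a = begin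
    (x ^ℚ a) * evalUpTo D (section (f ⊛ g) a) xs
      ≡⟨ cong ((x ^ℚ a) *_) (evalUpTo-∑ D (suc a) (λ i → section f (toℕ i) ⊛ section g (a ℕ.∸ toℕ i)) xs) ⟩
    (x ^ℚ a) * ∑[ i ≤ a ] evalUpTo D (section f (toℕ i) ⊛ section g (a ℕ.∸ toℕ i)) xs
      ≡⟨ *-distribˡ-sum {suc a} (x ^ℚ a) (λ i → evalUpTo D (section f (toℕ i) ⊛ section g (a ℕ.∸ toℕ i)) xs) ⟩
    ∑[ i ≤ a ] ((x ^ℚ a) * evalUpTo D (section f (toℕ i) ⊛ section g (a ℕ.∸ toℕ i)) xs)
      ≡⟨ sum-cong-≗ {suc a} (λ i → trans
           (cong₂ _*_
             (trans (cong (x ^ℚ_) (sym (ℕ.m+[n∸m]≡n (toℕ≤pred[n] i)))) (^ℚ-+ x (toℕ i) (a ℕ.∸ toℕ i)))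
             (evalUpTo-⊛ (section-vanishes (toℕ i) f≡0) (section-vanishes (a ℕ.∸ toℕ i) g≡0) d+d′≤D xs))
           (solve 4 (λ p q y z → p :* q :* (y :* z) := p :* y :* (q :* z)) refl
             (x ^ℚ toℕ i) (x ^ℚ (a ℕ.∸ toℕ i))
             (evalUpTo D (section f (toℕ i)) xs) (evalUpTo D (section g (a ℕ.∸ toℕ i)) xs))) ⟩
    ∑[ i ≤ a ] (s (toℕ i) * t (a ℕ.∸ toℕ i)) ∎

eval-bound : ∀ f {D} → bound f ≤ D → ∀ xs → eval f xs ≡ evalUpTo D (coeff f) xs
eval-bound f b≤D xs = sym (evalUpTo-stable (bounded f) b≤D xs)

eval-cong : ∀ f g → f ≈ g → ∀ xs → eval f xs ≡ eval g xs
eval-cong f g f≈g xs = begin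
  eval f xs                                  ≡⟨ eval-bound f (ℕ.m≤m+n (bound f) (bound g)) xs ⟩
  evalUpTo (bound f ℕ.+ bound g) (coeff f) xs  ≡⟨ evalUpTo-cong (bound f ℕ.+ bound g) f≈g xs ⟩
  evalUpTo (bound f ℕ.+ bound g) (coeff g) xs  ≡⟨ eval-bound g (ℕ.m≤n+m (bound g) (bound f)) xs ⟨
  eval g xs                                  ∎
  where open ≡-Reasoning

eval-0 : ∀ xs → eval 0Λ xs ≡ 0ℚ
eval-0 = evalUpTo-zero 0 (λ _ → refl)

eval-+ : ∀ f g xs → eval (f Sym.+ g) xs ≡ eval f xs + eval g xs
eval-+ f g xs = trans
  (evalUpTo-+ (bound f ℕ.+ bound g) (coeff f) (coeff g) xs)
  (sym (cong₂ _+_ (eval-bound f (ℕ.m≤m+n (bound f) (bound g)) xs)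
                  (eval-bound g (ℕ.m≤n+m (bound g) (bound f)) xs)))

eval-• : ∀ q f xs → eval (q • f) xs ≡ q * eval f xs
eval-• q f xs = evalUpTo-scale (bound f) q (coeff f) xs

eval-* : ∀ f g xs → eval (f Sym.* g) xs ≡ eval f xs * eval g xs
eval-* f g xs = trans
  (evalUpTo-⊛ (bounded f) (bounded g) ℕ.≤-refl xs)
  (sym (cong₂ _*_ (eval-bound f (ℕ.m≤m+n (bound f) (bound g)) xs)
                  (eval-bound g (ℕ.m≤n+m (bound g) (bound f)) xs)))

eval-∑ : ∀ n (f : Vector Λ n) xs → eval (sumΛ-syntax n f) xs ≡ ∑[ i < n ] eval (f i) xs
eval-∑ zero    f xs = eval-0 xs
eval-∑ (suc n) f xs = trans
  (eval-+ (f fzero) (sumΛ-syntax n (f ∘ fsuc)) xs)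
  (cong (λ y → eval (f fzero) xs + y) (eval-∑ n (f ∘ fsuc) xs))

-- (1 + x₁ t) ⋯ (1 + xᵣ t)
elementary : List ℚ → ℕ → ℚ
elementary []       = δ
elementary (x ∷ xs) = linear 1ℚ x (elementary xs)

-- Only the exponents 0 and 1 occur in a squarefree monomial, and they account for the two summands
-- of a linear factor. The cutoff is a successor so that both are present; `eval-e` has to enlarge
-- the bound of `e k` for this, as that of `e 0` is 0.
evalUpTo-e : ∀ d k xs → evalUpTo (suc d) (e-coeff k) xs ≡ elementary xs k
evalUpTo-e d zero    []       = refl
evalUpTo-e d (suc k) []       = refl
evalUpTo-e d k       (x ∷ xs) = begin
  1ℚ * evalUpTo (suc d) (e-coeff k) xs
    + ((x * 1ℚ) * evalUpTo (suc d) (section (e-coeff k) 1) xs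
    + ∑[ a < d ] ((x ^ℚ suc (suc (toℕ a))) * evalUpTo (suc d) (section (e-coeff k) (suc (suc (toℕ a)))) xs))
    ≡⟨ cong₂ _+_ (cong (1ℚ *_) (evalUpTo-e d k xs)) (cong₂ _+_ (cong₂ _*_ (ℚ.*-identityʳ x) (once k))
         (∑-zero d (λ a → trans
           (cong ((x ^ℚ suc (suc (toℕ a))) *_) (evalUpTo-zero (suc d) (λ _ → refl) xs))
           (ℚ.*-zeroʳ (x ^ℚ suc (suc (toℕ a))))))) ⟩
  1ℚ * elementary xs k + (x * shift (elementary xs) k + 0ℚ)
    ≡⟨ cong (λ y → 1ℚ * elementary xs k + y) (ℚ.+-identityʳ (x * shift (elementary xs) k)) ⟩
  linear 1ℚ x (elementary xs) k ∎
  where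
  open ≡-Reasoning
  once : ∀ k → evalUpTo (suc d) (section (e-coeff k) 1) xs ≡ shift (elementary xs) k
  once zero    = evalUpTo-zero (suc d) (λ α → cong (if_then 1ℚ else 0ℚ) (∧-zeroʳ (squarefree α))) xs
  once (suc k) = evalUpTo-e d k xs

eval-e : ∀ k xs → eval (e k) xs ≡ elementary xs k
eval-e k xs = trans (eval-bound (e k) (ℕ.n≤1+n k) xs) (evalUpTo-e k k xs)

elementary-applyUpTo : ∀ (x : ℕ → ℚ) (g : ℕ → ℕ) n → elementary (map x (applyUpTo g n)) ≗ ∏ one (x ∘ g) n
elementary-applyUpTo x g zero    k = refl
elementary-applyUpTo x g (suc n) k = trans
  (linear-cong 1ℚ (x (g 0)) (elementary-applyUpTo x (g ∘ suc) n) k)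
  (sym (∏-front one (x ∘ g) n k))

/-inv : ∀ p i → + p / suc i ≡ ι (+ p) * inv i
/-inv p i = begin
  x                             ≡⟨ ℚ.*-identityʳ x ⟨
  x * 1ℚ                        ≡⟨ cong (x *_) (inv-* i) ⟨
  x * (inv i * ι (+ suc i))     ≡⟨ solve 3 (λ x y z → x :* (y :* z) := x :* z :* y) refl
                                     x (inv i) (ι (+ suc i)) ⟩
  x * ι (+ suc i) * inv i       ≡⟨ cong (_* inv i) (/-*-cancel (+ p) (suc i)) ⟩
  ι (+ p) * inv i               ∎
  where
  open ≡-Reasoning
  open ℚ.+-*-Solver
  x = + p / suc i

eval-e-fractions : ∀ n k → eval (e k) (fractions (suc n)) ≡ E n k
eval-e-fractions n k = begin
  eval (e k) (fractions (suc n))       ≡⟨ eval-e k (fractions (suc n)) ⟩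
  elementary (fractions (suc n)) k     ≡⟨ elementary-applyUpTo (λ i → + suc n / suc i) id n k ⟩
  ∏ one (λ i → + suc n / suc i) n k    ≡⟨ ∏-cong n (λ _ → refl) (λ {i} _ → /-inv (suc n) i) k ⟩
  E n k                                ∎
  where open ≡-Reasoning

ι-^ : ∀ z j → ι (z ℤ.^ j) ≡ ι z ^ℚ j
ι-^ z zero    = refl
ι-^ z (suc j) = trans (ι-* z (z ℤ.^ j)) (cong (ι z *_) (ι-^ z j))

eval-β-fractions : ∀ n m k → eval (β m k) (fractions (suc n)) ≡
  E n k + - ∑[ j < m ] ((-1ℚ ^ℚ toℕ j) * (binom (toℕ j) k * E n (toℕ j)))
eval-β-fractions n m k = begin
  eval (β m k) xs
    ≡⟨ eval-+ (e k) (sumΛ-syntax m t) xs ⟩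
  eval (e k) xs + eval (sumΛ-syntax m t) xs
    ≡⟨ cong₂ _+_ (eval-e-fractions n k) (eval-∑ m t xs) ⟩
  E n k + ∑[ j < m ] eval (t j) xs
    ≡⟨ cong (λ y → E n k + y) (sum-cong-≗ {m} (λ j → eval-term (toℕ j))) ⟩
  E n k + ∑[ j < m ] (-1ℚ * term (toℕ j))
    ≡⟨ cong (λ y → E n k + y) (*-distribˡ-sum {m} -1ℚ (term ∘ toℕ)) ⟨
  E n k + -1ℚ * ∑[ j < m ] term (toℕ j)
    ≡⟨ solve 2 (λ x y → x :+ con -1ℚ :* y := x :+ :- y) refl (E n k) (∑[ j < m ] term (toℕ j)) ⟩
  E n k + - ∑[ j < m ] term (toℕ j) ∎
  where
  open ≡-Reasoning
  open ℚ.+-*-Solver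
  xs = fractions (suc n)
  sgn : ℕ → ℤ
  sgn j = ℤ.-1ℤ ℤ.^ suc j ℤ.* + (j C k)
  t : Vector Λ m
  t j = ι (sgn (toℕ j)) • e (toℕ j)
  term : ℕ → ℚ
  term j = (-1ℚ ^ℚ j) * (binom j k * E n j)
  eval-term : ∀ j → eval (ι (sgn j) • e j) xs ≡ -1ℚ * term j
  eval-term j = begin
    eval (ι (sgn j) • e j) xs
      ≡⟨ eval-• (ι (sgn j)) (e j) xs ⟩
    ι (sgn j) * eval (e j) xs
      ≡⟨ cong₂ _*_ (trans (ι-* (ℤ.-1ℤ ℤ.^ suc j) (+ (j C k))) (cong (_* binom j k) (ι-^ ℤ.-1ℤ (suc j))))
                    (eval-e-fractions n j) ⟩
    -1ℚ * (-1ℚ ^ℚ j) * binom j k * E n j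
      ≡⟨ solve 4 (λ m s b x → m :* s :* b :* x := m :* (s :* (b :* x))) refl
           -1ℚ (-1ℚ ^ℚ j) (binom j k) (E n j) ⟩
    -1ℚ * term j ∎

-- Values for large primes

coeff-zeros : ∀ f α z → coeff f (α ++ replicate z 0) ≡ coeff f α
coeff-zeros f α zero    = cong (coeff f) (++-identityʳ α)
coeff-zeros f α (suc z) = begin
  coeff f (α ++ 0 ∷ replicate z 0)     ≡⟨ cong (coeff f) (∷ʳ-++ α 0 (replicate z 0)) ⟨
  coeff f (α ∷ʳ 0 ++ replicate z 0)    ≡⟨ coeff-zeros f (α ∷ʳ 0) z ⟩
  coeff f (α ∷ʳ 0)                     ≡⟨ padding f α ⟩
  coeff f α                            ∎
  where open ≡-Reasoning

-- A symmetric function has the same coefficient at α and at its nonzero entries. Each of these is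
-- at least 1, so their number is at most the degree: up to a given degree only finitely many
-- coefficients remain, whatever the number of variables.
record NonzeroPart (α : List ℕ) : Set where
  field
    part       : List ℕ
    zeros      : ℕ
    rearranged : α ↭ part ++ replicate zeros 0
    short      : length part ≤ sum α
    same-sum   : sum part ≡ sum α

nonzeroPart : ∀ α → NonzeroPart α
nonzeroPart [] = record { part = [] ; zeros = 0 ; rearranged = ↭-refl ; short = z≤n ; same-sum = refl }
nonzeroPart (zero ∷ α) = record
  { part = part ; zeros = suc zeros
  ; rearranged = ↭-trans (prep 0 rearranged) (↭-sym (↭-shift 0 part (replicate zeros 0)))
  ; short = short ; same-sum = same-sum }
  where open NonzeroPart (nonzeroPart α)
nonzeroPart (suc a ∷ α) = record
  { part = suc a ∷ part ; zeros = zeros ; rearranged = prep (suc a) rearranged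
  ; short = s≤s (ℕ.≤-trans short (ℕ.m≤n+m (sum α) a)) ; same-sum = cong (suc a ℕ.+_) same-sum }
  where open NonzeroPart (nonzeroPart α)

bounded-upTo : ∀ (h : ℕ → ℕ) d → Σ[ B ∈ ℕ ] (∀ a → a ≤ d → h a ≤ B)
bounded-upTo h zero    = h 0 , λ { zero z≤n → ℕ.≤-refl }
bounded-upTo h (suc d) with bounded-upTo (h ∘ suc) d
... | B , h≤B = h 0 ⊔ B , λ
  { zero    _         → ℕ.m≤m⊔n (h 0) B
  ; (suc a) (s≤s a≤d) → ℕ.≤-trans (h≤B a a≤d) (ℕ.m≤n⊔m (h 0) B) }

bounded-on-exponents : ∀ (h : List ℕ → ℕ) l d → Σ[ B ∈ ℕ ] (∀ α → length α ≤ l → sum α ≤ d → h α ≤ B)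
bounded-on-exponents h zero    d = h [] , λ { [] _ _ → ℕ.≤-refl }
bounded-on-exponents h (suc l) d = h [] ⊔ B , λ
  { []      _           _   → ℕ.m≤m⊔n (h []) B
  ; (a ∷ α) (s≤s len≤l) s≤d → ℕ.≤-trans (proj₂ (tails a) α len≤l (ℕ.m+n≤o⇒n≤o a s≤d))
      (ℕ.≤-trans (proj₂ heads a (ℕ.m+n≤o⇒m≤o a s≤d)) (ℕ.m≤n⊔m (h []) B)) }
  where
  tails : ∀ a → Σ[ B ∈ ℕ ] (∀ α → length α ≤ l → sum α ≤ d → h (a ∷ α) ≤ B)
  tails a = bounded-on-exponents (h ∘ (a ∷_)) l d
  heads = bounded-upTo (proj₁ ∘ tails) d
  B = proj₁ heads

-- Above degree `bound f` every coefficient is 0; below it, `NonzeroPart` reduces to finitely many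
-- exponent lists. The bound depends on f alone, so it can serve as a threshold for p.
coeff-denominators-bounded : ∀ f → Σ[ B ∈ ℕ ] (∀ α → ↧ₙ (coeff f α) ≤ B)
coeff-denominators-bounded f with bounded-on-exponents (λ α → ↧ₙ (coeff f α)) (bound f) (bound f)
-- The 1 is the denominator of the coefficients that vanish for reasons of degree.
... | B , ≤B = 1 ⊔ B , all
  where
  all : ∀ α → ↧ₙ (coeff f α) ≤ 1 ⊔ B
  all α with sum α ℕ.≤? bound f
  ... | no α≰b  = ℕ.≤-trans (ℕ.≤-reflexive (cong ↧ₙ_ (bounded f α (ℕ.≰⇒> α≰b)))) (ℕ.m≤m⊔n 1 B)
  ... | yes α≤b = ℕ.≤-trans (ℕ.≤-reflexive (cong ↧ₙ_ (trans
      (symmetric f rearranged) (coeff-zeros f part zeros))))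
    (ℕ.≤-trans (≤B part (ℕ.≤-trans short α≤b) (ℕ.≤-trans (ℕ.≤-reflexive same-sum) α≤b)) (ℕ.m≤n⊔m 1 B))
    where open NonzeroPart (nonzeroPart α)

-- The prime is n + 1.
Eventually : (∀ {n} → Prime (suc n) → Set) → Set
Eventually A = Σ[ B ∈ ℕ ] (∀ {n} (p-prime : Prime (suc n)) → B ≤ n → A p-prime)

always : ∀ {A : ∀ {n} → Prime (suc n) → Set} →
  (∀ {n} (p-prime : Prime (suc n)) → A p-prime) → Eventually A
always a = 0 , λ p-prime _ → a p-prime

eventually₂ : ∀ {A B C : ∀ {n} → Prime (suc n) → Set} →
  (∀ {n} (p-prime : Prime (suc n)) → A p-prime → B p-prime → C p-prime) →
  Eventually A → Eventually B → Eventually C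
eventually₂ h (M , a) (N , b) = M ⊔ N , λ p-prime le →
  h p-prime (a p-prime (ℕ.m⊔n≤o⇒m≤o M N le)) (b p-prime (ℕ.m⊔n≤o⇒n≤o M N le))

eventually-∀ : ∀ m {A : Fin m → ∀ {n} → Prime (suc n) → Set} →
  (∀ i → Eventually (A i)) → Eventually (λ p-prime → ∀ i → A i p-prime)
eventually-∀ zero    ev = 0 , λ _ _ ()
eventually-∀ (suc m) {A} ev = eventually₂ {A fzero} {λ p-prime → ∀ i → A (fsuc i) p-prime}
  (λ { _ a as fzero → a ; _ a as (fsuc i) → as i }) (ev fzero) (eventually-∀ m (ev ∘ fsuc))

↧≤⇒integral : ∀ {n} (p-prime : Prime (suc n)) x → ↧ₙ x ≤ n → OddPrime.Integral p-prime x
↧≤⇒integral p-prime x ↧≤n = OddPrime.integral λ p∣↧ → ℕ.<⇒≱ (s≤s ↧≤n) (∣⇒≤ p∣↧)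

module _ {n} (p-prime : Prime (suc n)) where
  open OddPrime p-prime

  evalUpTo-integral : ∀ d {f} → (∀ α → Integral (f α)) → ∀ {xs} → All Integral xs → Integral (evalUpTo d f xs)
  evalUpTo-integral d f∈ []          = f∈ []
  evalUpTo-integral d f∈ (x∈ ∷ xs∈) = ∈ℤ-∑ (suc d) _ λ a →
    ∈ℤ-* (∈ℤ-^ (toℕ a) x∈) (evalUpTo-integral d (λ α → f∈ (toℕ a ∷ α)) xs∈)

  fractions-integral : All Integral (fractions (suc n))
  fractions-integral = All.map⁺ (All.applyUpTo⁺₁ id n λ i<n →
    ∈ℤ-/ (+ suc n) _ λ p∣i → ℕ.<⇒≱ (s≤s i<n) (∣⇒≤ p∣i))

-- Intended for the coefficients `g k` of a combination of the β: multiplying by an integral value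
-- preserves divisibility by p^n. A prime beyond the common bound divides none of the denominators.
eval-integral : ∀ f → Eventually λ {n} p-prime → OddPrime.Integral p-prime (eval f (fractions (suc n)))
eval-integral f = proj₁ denominators , λ p-prime B≤n → evalUpTo-integral p-prime (bound f)
  (λ α → ↧≤⇒integral p-prime (coeff f α) (ℕ.≤-trans (proj₂ denominators α) B≤n)) (fractions-integral p-prime)
  where denominators = coeff-denominators-bounded f

-- Divisibility of values on 𝓘ₙ and on the ideal of the β

Multiple : Λ → ℕ → ∀ {n} → Prime (suc n) → Set
Multiple f m {n} p-prime = OddPrime._∈p^_ p-prime (eval f (fractions (suc n))) m

-- Exponents of p add under products just as H-degrees do, so the generators decide. A derivation of
-- homogeneity is finite, and the maximum of the thresholds met along it is again a threshold.
homogeneous-multiple : ∀ {m f} → IsHomogeneous m f → Eventually (Multiple f m)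
homogeneous-multiple (constant q) = ↧ₙ q , λ {n} p-prime ↧≤n → let open OddPrime p-prime in
  subst (_∈p^ 0) (sym (trans (eval-• q 1Λ (fractions (suc n))) (cong (q *_) (eval-e-fractions n 0))))
    (∈p^-*ˡ (↧≤⇒integral p-prime q ↧≤n) (E∈p^ 0))
-- The threshold k + 1 ≤ p - 1 avoids k = p - 1, where E_k = p^k/(p-1)! has no further factor p.
homogeneous-multiple (elem k 1≤k) = suc k , λ {n} p-prime k<n → let open OddPrime p-prime in
  subst (_∈p^ (k ℕ.+ 1)) (sym (eval-e-fractions n k)) (E∈p^[k+1] k 1≤k k<n)
homogeneous-multiple (IsHomogeneous.zero m) = always λ {n} p-prime → let open OddPrime p-prime in
  subst (_∈p^ m) (sym (eval-0 (fractions (suc n)))) (∈p^-0 m)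
homogeneous-multiple (add {m} {f} {g} hf hg) = eventually₂ {Multiple f m} {Multiple g m}
  (λ {n} p-prime f∈ g∈ → let open OddPrime p-prime in
    subst (_∈p^ m) (sym (eval-+ f g (fractions (suc n)))) (∈p^-+ f∈ g∈))
  (homogeneous-multiple hf) (homogeneous-multiple hg)
homogeneous-multiple (mul {l} {m} {f} {g} hf hg) = eventually₂ {Multiple f l} {Multiple g m}
  (λ {n} p-prime f∈ g∈ → let open OddPrime p-prime in
    subst (_∈p^ (l ℕ.+ m)) (sym (eval-* f g (fractions (suc n)))) (∈p^-* f∈ g∈))
  (homogeneous-multiple hf) (homogeneous-multiple hg)
homogeneous-multiple (resp {m} {f} {g} f≈g hf) = proj₁ f∈ , λ {n} p-prime B≤n → let open OddPrime p-prime in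
  subst (_∈p^ m) (eval-cong f g f≈g (fractions (suc n))) (proj₂ f∈ p-prime B≤n)
  where
  f∈ : Eventually (Multiple f m)
  f∈ = homogeneous-multiple hf

∑-multiple : ∀ m (f : Vector Λ m) {l} → (∀ i → Eventually (Multiple (f i) l)) →
  Eventually (Multiple (sumΛ-syntax m f) l)
∑-multiple m f {l} f∈ = proj₁ all , λ {n} p-prime B≤n → let open OddPrime p-prime in
  subst (_∈p^ l) (sym (eval-∑ m f (fractions (suc n)))) (∈p^-∑ m _ (proj₂ all p-prime B≤n))
  where
  all : Eventually (λ p-prime → ∀ i → Multiple (f i) l p-prime)
  all = eventually-∀ m {λ i → Multiple (f i) l} f∈

-- Membership in 𝓘ₙ bounds the degrees of components that are not zero, so for lower degrees it
-- yields only a double negation. Equality of rationals is decidable, which removes it one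
-- coefficient at a time.
≈0-stable : ∀ {f} → ¬ ¬ (f ≈ 0Λ) → f ≈ 0Λ
≈0-stable {f} ¬¬f≈0 α = decidable-stable (coeff f α ℚ.≟ 0ℚ) λ fα≢0 → ¬¬f≈0 λ f≈0 → fα≢0 (f≈0 α)

𝓘-multiple : ∀ {f m} → f ∈𝓘 m → Eventually (Multiple f m)
𝓘-multiple {f} {m} (D , below) = proj₁ ∑∈ , λ {n} p-prime B≤n → let open OddPrime p-prime in
  subst (_∈p^ m)
    (sym (eval-cong f (sumΛ-syntax (cutoff D) (component D ∘ toℕ)) (total D) (fractions (suc n))))
    (proj₂ ∑∈ p-prime B≤n)
  where
  component-multiple : ∀ l → Eventually (Multiple (component D l) m)
  component-multiple l with m ℕ.≤? l
  ... | yes m≤l = let B , ∈l = homogeneous-multiple (homogeneous D l) in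
    B , λ p-prime B≤n → OddPrime.∈p^-≤ p-prime m≤l (∈l p-prime B≤n)
  ... | no m≰l  = always λ {n} p-prime → let open OddPrime p-prime in
    subst (_∈p^ m)
      (sym (trans (eval-cong (component D l) 0Λ (≈0-stable {component D l} (m≰l ∘ below l))
                    (fractions (suc n)))
                  (eval-0 (fractions (suc n)))))
      (∈p^-0 m)
  ∑∈ = ∑-multiple (cutoff D) (component D ∘ toℕ) {m} (component-multiple ∘ toℕ)

β-multiple : ∀ m k → Eventually (Multiple (β m k) m)
-- Here 2 ≤ p - 1 makes p odd, and m ≤ p - 1 keeps the truncation within the range of indices of E.
β-multiple m k = 2 ⊔ m , λ {n} p-prime le → let open OddPrime p-prime in
  subst (_∈p^ m) (sym (eval-β-fractions n m k))
    (E-truncated (ℕ.m⊔n≤o⇒m≤o 2 m le) m (ℕ.m≤n⇒m≤1+n (ℕ.m⊔n≤o⇒n≤o 2 m le)) k)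

ideal-multiple : ∀ {m f} → f ∈I[ m ] → Eventually (Multiple f m)
ideal-multiple {m} {f} (N , g , f-S∈𝓘) =
  eventually₂ {Multiple (f Sym.- S) m} {Multiple S m} combine (𝓘-multiple {f Sym.- S} f-S∈𝓘) S-multiple
  where
  S = sumΛ-syntax N (λ k → g k Sym.* β m (toℕ k))
  S-multiple : Eventually (Multiple S m)
  S-multiple = ∑-multiple N _ λ k → eventually₂
    {λ {n} p-prime → OddPrime.Integral p-prime (eval (g k) (fractions (suc n)))} {Multiple (β m (toℕ k)) m}
    (λ {n} p-prime g∈ β∈ → let open OddPrime p-prime in
      subst (_∈p^ m) (sym (eval-* (g k) (β m (toℕ k)) (fractions (suc n)))) (∈p^-*ˡ g∈ β∈))
    (eval-integral (g k)) (β-multiple m (toℕ k))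
  combine : ∀ {n} (p-prime : Prime (suc n)) →
    Multiple (f Sym.- S) m p-prime → Multiple S m p-prime → Multiple f m p-prime
  combine {n} p-prime f-S∈ S∈ = subst (_∈p^ m) eq (∈p^-+ f-S∈ S∈)
    where
    open OddPrime p-prime
    open ℚ.+-*-Solver
    xs = fractions (suc n)
    eq : eval (f Sym.- S) xs + eval S xs ≡ eval f xs
    eq = trans
      (cong (_+ eval S xs) (trans (eval-+ f ((- 1ℚ) • S) xs)
        (cong (λ y → eval f xs + y) (eval-• (- 1ℚ) S xs))))
      (solve 2 (λ x y → x :+ con -1ℚ :* y :+ y := x) refl (eval f xs) (eval S xs))

theorem3p3 : (n : ℕ) (f : Λ) → f ∈I[ n ] →
    Σ[ P ∈ ℕ ] ((p : ℕ) → Prime p → P ≤ p →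
    eval f (fractions p) ≡ 0ℚ mod p ^ n)
-- Thresholds are compared with p - 1, hence the successor.
theorem3p3 n f f∈I = suc (proj₁ f∈) , λ
  { zero    p-prime _         → contradiction p-prime ¬prime[0]
  ; (suc m) p-prime (s≤s B≤m) → OddPrime.∈p^⇒≡0 p-prime (proj₂ f∈ p-prime B≤m) }
  where
  f∈ : Eventually (Multiple f n)
  f∈ = ideal-multiple {n} {f} f∈I
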